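{- Let $\mathbb{P}$ be the forcing poset consisting of triples $(T,F,A)$ satisfying: (1) $T=(|T|,<_T)$ is a finite tree on $\omega_1$; (2) $F$ is an injective function from the set of maximal nodes of $T$ into $\omega_2$; (3) $A$ is a finite adequate set; (4) if $M\in A$, $a$ and $b$ are distinct maximal nodes of $T$, and $F(a),F(b)\in M$, then every $c$ which is below both $a$ and $b$ in $T$ is in $M$; ordered by $(U,G,B)\le(T,F,A)$ iff $U$ end-extends $T$, $A\subseteq B$, and whenever $a$ is maximal in $T$ there is $b$ maximal in $U$ such that $a\le_U b$ and $F(a)=G(b)$. Let $\dot R$ be a $\mathbb{P}$-name for the set of pairs $(\alpha,\beta)$ for which there is $(T,F,A)\in\dot G$ (the generic filter) with $\alpha<_T\beta$, and let $\dot T$ be a $\mathbb{P}$-name for the tree $(\omega_1,\dot R)$. Then $\mathbb{P}$ forces that each level of $\dot T$ is countable.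
   Context: Standing assumptions and notation. Assume $2^{\omega_1}=\omega_2$ and fix a bijection $\pi:\omega_2\to H(\omega_2)$. $P_{\omega_1}(\omega_2)$ is the set of countable subsets of $\omega_2$. Assume there is a stationary set $\mathcal{Y}\subseteq P_{\omega_1}(\omega_2)$ which is thin, i.e. for all $\beta<\omega_2$ the set $\{a\cap\beta: a\in\mathcal{Y}\}$ has size at most $\omega_1$; fix such a $\mathcal{Y}$ which is moreover closed under initial segments ($a\in\mathcal{Y}$, $\beta<\omega_2$ imply $a\cap\beta\in\mathcal{Y}$). Let $\mathcal{A}$ be the structure $(H(\omega_2),\in,\pi,\mathcal{Y})$, which has definable Skolem functions (via the well-ordering induced by $\pi$). For $a\subseteq H(\omega_2)$, $Sk(a)$ is the closure of $a$ under a fixed set of definable Skolem functions for $\mathcal{A}$. Let $C$ be the (club) set of $\beta<\omega_2$ with $Sk(\beta)\cap\omega_2=\beta$, and let $\Lambda$ be the set of $\beta<\omega_2$ of cofinality $\omega_1$ which are limit points of $C$. Let $\mathcal{X}$ be the set of $M\in\mathcal{Y}$ such that $Sk(M)\cap\omega_2=M$ and for all $\gamma\in M$, $\sup(C\cap\gamma)\in M$. Comparison points and adequacy. Fix a set $\Gamma\subseteq\Lambda$ which is stationary in $\omega_2$. For $M\in\mathcal{X}$, $\Gamma_M$ is the set of $\beta\in\Gamma$ such that $\beta=\min(\Gamma\setminus\sup(M\cap\beta))$, i.e. $\Gamma\cap[\sup(M\cap\beta),\beta)=\emptyset$. For $M,N\in\mathcal{X}$, $\Gamma_M\cap\Gamma_N$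 has a largest element, denoted $\beta_{M,N}$. A set $A\subseteq\mathcal{X}$ is adequate if for all $M,N\in A$, either $M\cap\beta_{M,N}=N\cap\beta_{M,N}$, or $M\cap\beta_{M,N}\in Sk(N)$, or $N\cap\beta_{M,N}\in Sk(M)$. Finite trees. A finite tree on $\omega_1$ is a pair $T=(|T|,<_T)$ such that $|T|$ is a finite subset of $\omega_1$; $<_T$ is an irreflexive transitive relation on $|T|$; if $a,b<_T c$ then $a=b$, $a<_T b$ or $b<_T a$; and $a<_T b$ implies $a<b$. $U$ end-extends $T$ if $|T|\subseteq|U|$ and $<_U\cap(|T|\times|T|)=\ <_T$. $\mathbb{P}$ preserves $\omega_1$ and $\omega_2$. -}

module Defs where

open import Level using (Level; _⊔_) renaming (zero to 0ℓ; suc to lsuc)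
open import Data.Bool.Base using (Bool; T; _∧_; if_then_else_)
open import Data.Nat.Base using (ℕ; zero; suc)
open import Data.Fin.Base using (Fin)
open import Data.Vec.Base using (Vec; _∷_; lookup)
open import Data.List.Base using (List)
open import Data.List.Membership.Propositional using (_∈_)
open import Data.List.Relation.Unary.All using (All)
open import Data.Product.Base using (Σ; ∃; _×_; _,_; proj₁; proj₂)
open import Data.Sum.Base using (_⊎_; [_,_]′)
open import Data.Unit.Base using (⊤)
open import Data.Empty using (⊥)
open import Function.Base using (const; _∘_)
open import Function.Definitions using (Bijective)
open import Induction.WellFounded using (WellFounded; Acc; acc)
open import Relation.Binary.Structures using (IsStrictTotalOrder)
open import Relation.Binary.PropositionalEquality.Core using (_≡_; _≢_)
open import Relation.Nullary.Negation.Core using (¬_)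
open import Relation.Nullary.Decidable.Core using (⌊_⌋)

------------------------------------------------------------------------
-- The ordinal ω₂

-- The definitions are read classically: they are meant to be used together
-- with excluded middle for arbitrary types, Dec P, which also makes Σ a
-- classical existential quantifier.

-- ω₂ is presented up to isomorphism as a well-ordered type, so its elements
-- are the ordinals below ω₂, and ω₁ is one of them.  `Below β` is β viewed
-- as the set of its predecessors.
record Omega₂ : Set₁ where
  infix 4 _<_ _≤_ _≼_
  field
    Ord                : Set
    _<_                : Ord → Ord → Set
    isStrictTotalOrder : IsStrictTotalOrder _≡_ _<_
    wellFounded        : WellFounded _<_

  open IsStrictTotalOrder isStrictTotalOrder public using (_<?_)

  _≤_ : Ord → Ord → Set
  α ≤ β = α < β ⊎ α ≡ β

  Below : Ord → Ord → Set
  Below β ξ = ξ < β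

  Countable : (Ord → Set) → Set
  Countable A = ∃ λ (f : Ord → ℕ) → ∀ ξ η → A ξ → A η → f ξ ≡ f η → ξ ≡ η

  _≼_ : (Ord → Set) → (Ord → Set) → Set
  A ≼ B = ∃ λ (f : Ord → Ord) →
    (∀ ξ → A ξ → B (f ξ)) × (∀ ξ η → A ξ → A η → f ξ ≡ f η → ξ ≡ η)

  field
    ω₁             : Ord
    ω₁-uncountable : ¬ Countable (Below ω₁)
    <ω₁-countable  : ∀ α → α < ω₁ → Countable (Below α)
    below-≼-ω₁     : ∀ β → Below β ≼ Below ω₁
    ω₂-⋠-ω₁        : ¬ (const ⊤ ≼ Below ω₁)

------------------------------------------------------------------------
-- Sets of ordinals, clubs, stationary sets

module Ordinals (Ω : Omega₂) where
  open Omega₂ Ω public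

  infix 4 _∈ₛ_ _⊆ₛ_ _≐_
  infixl 7 _↾_

  -- Subsets of ω₂ that themselves occur as elements of other sets are given
  -- by (classical) characteristic functions, compared pointwise.
  Subset : Set
  Subset = Ord → Bool

  _∈ₛ_ : Ord → Subset → Set
  ξ ∈ₛ a = T (a ξ)

  Mem : Subset → Ord → Set
  Mem a ξ = ξ ∈ₛ a

  _⊆ₛ_ : Subset → Subset → Set
  a ⊆ₛ b = ∀ ξ → ξ ∈ₛ a → ξ ∈ₛ b

  _≐_ : Subset → Subset → Set
  a ≐ b = ∀ ξ → a ξ ≡ b ξ

  -- a ↾ β is a ∩ β.
  _↾_ : Subset → Ord → Subset
  (a ↾ β) ξ = a ξ ∧ ⌊ ξ <? β ⌋

  IsSup : (Ord → Set) → Ord → Set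
  IsSup A σ = (∀ ξ → A ξ → ξ ≤ σ) × (∀ τ → (∀ ξ → A ξ → ξ ≤ τ) → σ ≤ τ)

  IsLimitPoint : (Ord → Set) → Ord → Set
  IsLimitPoint D β =
    (∃ λ γ → γ < β) × (∀ γ → γ < β → ∃ λ δ → D δ × γ < δ × δ < β)

  IsClub : (Ord → Set) → Set
  IsClub D = (∀ α → ∃ λ β → D β × α < β) × (∀ β → IsLimitPoint D β → D β)

  IsStationary : (Ord → Set) → Set₁
  IsStationary S = ∀ (D : Ord → Set) → IsClub D → ∃ λ β → S β × D β

  HasCofinalMap : Ord → Ord → Set
  HasCofinalMap δ β = ∃ λ (f : Ord → Ord) →
    (∀ γ → γ < δ → f γ < β) × (∀ ξ → ξ < β → ∃ λ γ → γ < δ × ξ ≤ f γ)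

  HasCofinality : Ord → Ord → Set
  HasCofinality β δ = HasCofinalMap δ β × (∀ ε → ε < δ → ¬ HasCofinalMap ε β)

  IsUnion : (ℕ → Subset) → Subset → Set
  IsUnion c a = ∀ ξ → (ξ ∈ₛ a → ∃ λ n → ξ ∈ₛ c n) × (∀ n → ξ ∈ₛ c n → ξ ∈ₛ a)

  -- Clubs and stationary sets in P_{ω₁}(ω₂).
  IsClubP : (Subset → Set) → Set
  IsClubP D =
      (∀ a → D a → Countable (Mem a))
    × (∀ a → Countable (Mem a) → ∃ λ b → D b × a ⊆ₛ b)
    × (∀ (c : ℕ → Subset) a → (∀ n → D (c n)) → (∀ n → c n ⊆ₛ c (suc n)) →
         IsUnion c a → D a)

  IsStationaryP : (Subset → Set) → Set₁
  IsStationaryP S = ∀ (D : Subset → Set) → IsClubP D → ∃ λ a → S a × D a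

  -- 2^{ω₁} = ω₂: a bijection from ω₂ onto the power set of ω₁.
  Continuum : Set
  Continuum = ∃ λ (e : Ord → Subset) →
      (∀ α β → (∀ ξ → ξ < ω₁ → e α ξ ≡ e β ξ) → α ≡ β)
    × (∀ (a : Subset) → ∃ λ α → ∀ ξ → ξ < ω₁ → e α ξ ≡ a ξ)

------------------------------------------------------------------------
-- H(ω₂)

  -- Sets hereditarily of cardinality less than ω₂: `set β f` is the set
  -- { f γ : γ < β }, and every set of size at most ω₁ has this form.
  -- The proof of γ < β is irrelevant, so that f really is indexed by β.
  data H : Set where
    set : (β : Ord) → ((γ : Ord) → .(γ < β) → H) → H

  infix 4 _≈_ _∈ᴴ_

  _≈_ : H → H → Set
  set β f ≈ set δ g =
      (∀ γ (p : γ < β) → ∃ λ ε → Σ (ε < δ) λ q → f γ p ≈ g ε q)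
    × (∀ ε (q : ε < δ) → ∃ λ γ → Σ (γ < β) λ p → f γ p ≈ g ε q)

  _∈ᴴ_ : H → H → Set
  x ∈ᴴ set δ g = ∃ λ ε → Σ (ε < δ) λ q → x ≈ g ε q

  -- x is the von Neumann ordinal α.
  IsOrd : Ord → H → Set
  IsOrd α (set β f) =
      (∀ ξ → ξ < α → ∃ λ γ → Σ (γ < β) λ p → IsOrd ξ (f γ p))
    × (∀ γ (p : γ < β) → ∃ λ ξ → ξ < α × IsOrd ξ (f γ p))

  -- x is the set of (von Neumann) ordinals A.
  IsOrdSet : (Ord → Set) → H → Set
  IsOrdSet A x =
      (∀ ξ → A ξ → ∃ λ y → y ∈ᴴ x × IsOrd ξ y)
    × (∀ y → y ∈ᴴ x → ∃ λ ξ → A ξ × IsOrd ξ y)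

  -- A ⊆ ω₂ as a subset of H(ω₂).
  ords : (Ord → Set) → H → Set
  ords A x = ∃ λ ξ → A ξ × IsOrd ξ x

------------------------------------------------------------------------
-- The standing assumptions on π and 𝒴

record Setting : Set₁ where
  field
    Ω : Omega₂
  open Ordinals Ω public
  field
    continuum    : Continuum
    π            : Ord → H
    π-bijective  : Bijective _≡_ _≈_ π
    𝒴            : Subset → Set
    𝒴-resp-≐     : ∀ a b → a ≐ b → 𝒴 a → 𝒴 b
    𝒴-countable  : ∀ a → 𝒴 a → Countable (Mem a)
    𝒴-stationary : IsStationaryP 𝒴
    -- At most ω₁ many traces a ∩ β with a ∈ 𝒴, for each β.
    𝒴-thin       : ∀ β → ∃ λ (e : Ord → Subset) →
                     ∀ a → 𝒴 a → ∃ λ i → i < ω₁ × (a ↾ β) ≐ e i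
    𝒴-initial    : ∀ a β → 𝒴 a → 𝒴 (a ↾ β)

------------------------------------------------------------------------
-- The structure 𝒜 = (H(ω₂), ∈, π, 𝒴)

-- First-order formulas in n free variables (de Bruijn: ∃ᶠ binds variable 0).
data Formula : ℕ → Set where
  _∈ᶠ_ _=ᶠ_ _π↦_ : ∀ {n} → Fin n → Fin n → Formula n
  𝒴ᶠ             : ∀ {n} → Fin n → Formula n
  ¬ᶠ_            : ∀ {n} → Formula n → Formula n
  _∧ᶠ_           : ∀ {n} → Formula n → Formula n → Formula n
  ∃ᶠ_            : ∀ {n} → Formula (suc n) → Formula n

module Models (S : Setting) where
  open Setting S public

  infix 4 _⊨_

  _⊨_ : ∀ {n} → Vec H n → Formula n → Set
  v ⊨ (i ∈ᶠ j)  = lookup v i ∈ᴴ lookup v j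
  v ⊨ (i =ᶠ j)  = lookup v i ≈ lookup v j
  v ⊨ (i π↦ j)  = ∃ λ α → IsOrd α (lookup v i) × π α ≈ lookup v j
  v ⊨ 𝒴ᶠ i      = ∃ λ a → 𝒴 a × IsOrdSet (Mem a) (lookup v i)
  v ⊨ (¬ᶠ φ)    = ¬ (v ⊨ φ)
  v ⊨ (φ ∧ᶠ ψ)  = (v ⊨ φ) × (v ⊨ ψ)
  v ⊨ (∃ᶠ φ)    = ∃ λ x → (x ∷ v) ⊨ φ

  -- The Skolem function of φ(x, v) sends v to the witness x that comes first
  -- in the well-ordering of H(ω₂) induced by π (if there is a witness).
  IsSkolemValue : ∀ {n} → Formula (suc n) → Vec H n → H → Set
  IsSkolemValue φ v x = ∃ λ ξ →
    π ξ ≈ x × ((π ξ ∷ v) ⊨ φ) × (∀ η → η < ξ → ¬ ((π η ∷ v) ⊨ φ))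

  data Sk (A : H → Set) : H → Set where
    base   : ∀ {x} → A x → Sk A x
    skolem : ∀ {n} (φ : Formula (suc n)) (v : Vec H n) {x} →
             (∀ i → Sk A (lookup v i)) → IsSkolemValue φ v x → Sk A x

  -- Sk(A) ∩ ω₂ = A.
  SkClosed : (Ord → Set) → Set
  SkClosed A = ∀ ξ x → IsOrd ξ x → (Sk (ords A) x → A ξ) × (A ξ → Sk (ords A) x)

  C : Ord → Set
  C β = SkClosed (Below β)

  Λ : Ord → Set
  Λ β = HasCofinality β ω₁ × IsLimitPoint C β

  𝒳 : Subset → Set
  𝒳 M = 𝒴 M
      × SkClosed (Mem M)
      × (∀ γ → γ ∈ₛ M → ∃ λ σ → IsSup (λ ξ → C ξ × ξ < γ) σ × σ ∈ₛ M)

  -- a ∈ Sk(N), for a set of ordinals a and N ⊆ ω₂.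
  _∈Sk_ : Subset → Subset → Set
  a ∈Sk N = ∃ λ x → IsOrdSet (Mem a) x × Sk (ords (Mem N)) x

------------------------------------------------------------------------
-- Comparison points, adequate sets, the forcing poset

record FiniteTree (Ω : Omega₂) : Set where
  open Omega₂ Ω
  field
    nodes : List Ord
    lt    : Ord → Ord → Bool

  infix 4 _≺_ _≼ᵀ_

  _≺_ : Ord → Ord → Set
  a ≺ b = T (lt a b)

  _≼ᵀ_ : Ord → Ord → Set
  a ≼ᵀ b = a ≺ b ⊎ a ≡ b

  field
    nodes-<ω₁ : ∀ a → a ∈ nodes → a < ω₁
    ≺-nodes   : ∀ a b → a ≺ b → a ∈ nodes × b ∈ nodes
    ≺-irrefl  : ∀ a → ¬ (a ≺ a)
    ≺-trans   : ∀ a b c → a ≺ b → b ≺ c → a ≺ c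
    ≺-linear  : ∀ a b c → a ≺ c → b ≺ c → a ≡ b ⊎ a ≺ b ⊎ b ≺ a
    ≺⇒<       : ∀ a b → a ≺ b → a < b

  IsMaximal : Ord → Set
  IsMaximal a = a ∈ nodes × (∀ b → ¬ (a ≺ b))

module Poset (S : Setting) (Γ : Setting.Ord S → Set) where
  open Models S public
  open FiniteTree

  -- β ∈ Γ_M.
  IsCandidate : Subset → Ord → Set
  IsCandidate M β = Γ β × (∃ λ σ →
    IsSup (Mem (M ↾ β)) σ × σ ≤ β × (∀ γ → Γ γ → σ ≤ γ → β ≤ γ))

  -- β = β_{M,N}.
  IsComparison : Subset → Subset → Ord → Set
  IsComparison M N β = IsCandidate M β × IsCandidate N β
    × (∀ γ → IsCandidate M γ → IsCandidate N γ → γ ≤ β)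

  Adequate : List Subset → Set
  Adequate A = All 𝒳 A × (∀ M N → M ∈ A → N ∈ A →
    ∃ λ β → IsComparison M N β ×
      ((M ↾ β) ≐ (N ↾ β) ⊎ ((M ↾ β) ∈Sk N) ⊎ ((N ↾ β) ∈Sk M)))

  EndExtends : FiniteTree Ω → FiniteTree Ω → Set
  EndExtends U T = (∀ a → a ∈ nodes T → a ∈ nodes U)
    × (∀ a b → a ∈ nodes T → b ∈ nodes T → lt U a b ≡ lt T a b)

  -- Only the values of F at maximal nodes of the tree are meaningful.
  record Condition : Set where
    field
      tree        : FiniteTree Ω
      F           : Ord → Ord
      side        : List Subset
      F-injective : ∀ a b → IsMaximal tree a → IsMaximal tree b → F a ≡ F b → a ≡ b
      adequate    : Adequate side
      closed      : ∀ M a b c → M ∈ side →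
                    IsMaximal tree a → IsMaximal tree b → a ≢ b →
                    F a ∈ₛ M → F b ∈ₛ M →
                    _≺_ tree c a → _≺_ tree c b → c ∈ₛ M

  open Condition public

  -- Elements of the finite sets A are compared extensionally.
  _⊑_ : Condition → Condition → Set
  q ⊑ p = EndExtends (tree q) (tree p)
    × (∀ M → M ∈ side p → ∃ λ N → N ∈ side q × M ≐ N)
    × (∀ a → IsMaximal (tree p) a →
         ∃ λ b → IsMaximal (tree q) b × _≼ᵀ_ (tree q) a b × F p a ≡ F q b)

------------------------------------------------------------------------
-- Names and the forcing relation

module Forcing (P : Set) (_≤_ : P → P → Set) where

  -- name I x s is the name { (x i , s i) : i ∈ I }.
  data Name : Set₁ where
    name : (I : Set) → (I → Name) → (I → P) → Name

  -- A statement of the forcing language, identified with the set of conditions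
  -- forcing it.  Every statement built below is forced by p as soon as it is
  -- forced densely below p, so that ⇒̇ is classical implication.
  Stmt : (ℓ : Level) → Set (lsuc ℓ)
  Stmt ℓ = P → Set ℓ

  infix 5 _≈̇_ _∈̇_
  infixr 4 _∧̇_
  infixr 3 _⇒̇_ _⇔̇_

  -- p ⊩ x = y iff q ⊩ z ∈ y for all (z , s) ∈ x and q ≤ p , s, and
  -- symmetrically; p ⊩ x ∈ y iff the set of r with r ≤ t and r ⊩ x = z for
  -- some (z , t) ∈ y is dense below p.
  _≈̇_ : Name → Name → Stmt 0ℓ
  _∈̇_ : Name → Name → Stmt 0ℓ

  (a@(name I x s) ≈̇ b@(name J y t)) p =
      (∀ i q → q ≤ p → q ≤ s i → (x i ∈̇ b) q)
    × (∀ j q → q ≤ p → q ≤ t j → (y j ∈̇ a) q)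

  (a ∈̇ name J y t) p =
    ∀ q → q ≤ p → ∃ λ r → r ≤ q × (∃ λ j → r ≤ t j × (a ≈̇ y j) r)

  _∧̇_ : ∀ {a b} → Stmt a → Stmt b → Stmt (a ⊔ b)
  (φ ∧̇ ψ) p = φ p × ψ p

  ¬̇_ : ∀ {a} → Stmt a → Stmt a
  (¬̇ φ) p = ∀ q → q ≤ p → ¬ φ q

  _⇒̇_ : ∀ {a b} → Stmt a → Stmt b → Stmt (a ⊔ b)
  (φ ⇒̇ ψ) p = ∀ q → q ≤ p → φ q → ψ q

  _⇔̇_ : ∀ {a b} → Stmt a → Stmt b → Stmt (a ⊔ b)
  φ ⇔̇ ψ = (φ ⇒̇ ψ) ∧̇ (ψ ⇒̇ φ)

  ∀̇ : ∀ {a} → (Name → Stmt a) → Stmt (lsuc 0ℓ ⊔ a)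
  ∀̇ φ p = ∀ x → φ x p

  ∃̇ : ∀ {a} → (Name → Stmt a) → Stmt (lsuc 0ℓ ⊔ a)
  ∃̇ φ p = ∀ q → q ≤ p → ∃ λ r → r ≤ q × (∃ λ x → φ x r)

  ∀̇∈ : ∀ {a} → Name → (Name → Stmt a) → Stmt (lsuc 0ℓ ⊔ a)
  ∀̇∈ a φ = ∀̇ λ x → x ∈̇ a ⇒̇ φ x

  ∃̇∈ : ∀ {a} → Name → (Name → Stmt a) → Stmt (lsuc 0ℓ ⊔ a)
  ∃̇∈ a φ = ∃̇ λ x → x ∈̇ a ∧̇ φ x

  Forced : ∀ {a} → Stmt a → Set a
  Forced φ = ∀ p → φ p

  -- Check names use every condition in place of a greatest one:
  -- x̌ = { (y̌ , p) : y ∈ x, p ∈ P }.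
  setOf : (I : Set) → (I → Name) → Name
  setOf I x = name (I × P) (x ∘ proj₁) proj₂

  upair : Name → Name → Name
  upair x y = setOf Bool λ b → if b then x else y

  -- A name for the (Kuratowski) ordered pair.
  opair : Name → Name → Name
  opair x y = upair (upair x x) (upair x y)

  -- A name for x ∪ {x}.
  succ : Name → Name
  succ a@(name I x s) = name (I ⊎ P) [ x , const a ]′ [ s , (λ p → p) ]′

  numeral : ℕ → Name
  numeral zero    = setOf ⊥ λ ()
  numeral (suc n) = succ (numeral n)

  ω̌ : Name
  ω̌ = setOf ℕ numeral

  -- f is a function from a to b.
  IsFunction : Name → Name → Name → Stmt (lsuc 0ℓ)
  IsFunction f a b =
      (∀̇∈ f λ z → ∃̇∈ a λ x → ∃̇∈ b λ y → z ≈̇ opair x y)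
    ∧̇ (∀̇∈ a λ x → ∃̇∈ b λ y → opair x y ∈̇ f)
    ∧̇ (∀̇ λ x → ∀̇ λ y → ∀̇ λ z → opair x y ∈̇ f ⇒̇ opair x z ∈̇ f ⇒̇ y ≈̇ z)

  IsInjection : Name → Name → Name → Stmt (lsuc 0ℓ)
  IsInjection f a b = IsFunction f a b
    ∧̇ (∀̇ λ x → ∀̇ λ y → ∀̇ λ z → opair x z ∈̇ f ⇒̇ opair y z ∈̇ f ⇒̇ x ≈̇ y)

  IsBijection : Name → Name → Name → Stmt (lsuc 0ℓ)
  IsBijection f a b = IsInjection f a b
    ∧̇ (∀̇∈ b λ y → ∃̇∈ a λ x → opair x y ∈̇ f)

  InjectsInto : Name → Name → Stmt (lsuc 0ℓ)
  InjectsInto a b = ∃̇ λ f → IsInjection f a b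

  IsCountable : Name → Stmt (lsuc 0ℓ)
  IsCountable a = InjectsInto a ω̌

  IsTransitive : Name → Stmt (lsuc 0ℓ)
  IsTransitive x = ∀̇∈ x λ y → ∀̇∈ y λ z → z ∈̇ x

  IsOrdinal : Name → Stmt (lsuc 0ℓ)
  IsOrdinal x = IsTransitive x ∧̇ (∀̇∈ x IsTransitive)

  -- κ is a cardinal, for an ordinal κ.
  IsCardinal : Name → Stmt (lsuc 0ℓ)
  IsCardinal κ = ∀̇∈ κ λ α → ¬̇ InjectsInto κ α

  -- The node x of the tree (X, R) has height α: (α, ∈) is isomorphic to the
  -- set of predecessors of x ordered by R.
  HasHeight : Name → Name → Name → Name → Stmt (lsuc 0ℓ)
  HasHeight X R x α = ∃̇ λ D → ∃̇ λ f →
      (∀̇ λ y → y ∈̇ D ⇔̇ (y ∈̇ X ∧̇ opair y x ∈̇ R))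
    ∧̇ IsBijection f α D
    ∧̇ (∀̇ λ ξ → ∀̇ λ η → ∀̇ λ y → ∀̇ λ z →
         opair ξ y ∈̇ f ⇒̇ opair η z ∈̇ f ⇒̇ (ξ ∈̇ η ⇔̇ opair y z ∈̇ R))

  -- L is level α of the tree (X, R).
  IsLevel : Name → Name → Name → Name → Stmt (lsuc 0ℓ)
  IsLevel X R α L = ∀̇ λ x → x ∈̇ L ⇔̇ (x ∈̇ X ∧̇ HasHeight X R x α)

  LevelsCountable : Name → Name → Stmt (lsuc 0ℓ)
  LevelsCountable X R =
    ∀̇ λ α → IsOrdinal α ⇒̇ (∀̇ λ L → IsLevel X R α L ⇒̇ IsCountable L)

------------------------------------------------------------------------
-- The generic tree

module GenericTree (S : Setting) (Γ : Setting.Ord S → Set) where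
  open Poset S Γ public
  open Forcing Condition _⊑_ public

  checkAcc : (α : Ord) → Acc _<_ α → Name
  checkAcc α (acc rs) = setOf (∃ λ ξ → ξ < α) λ (ξ , ξ<α) → checkAcc ξ (rs ξ<α)

  check : Ord → Name
  check α = checkAcc α (wellFounded α)

  ω̌₁ : Name
  ω̌₁ = check ω₁

  ω̌₂ : Name
  ω̌₂ = setOf Ord check

  -- { ((α̌, β̌), p) : α <_T β, where p = (T, F, A) }.
  Ṙ : Name
  Ṙ = name (∃ λ p → ∃ λ α → ∃ λ β → FiniteTree._≺_ (tree p) α β)
           (λ (_ , α , β , _) → opair (check α) (check β))
           proj₁

-- A node d that does not yet occur in a condition can be inserted below any node
-- e > d of its tree; clause (4) survives because every M ∈ 𝒳 meets ω₁ in an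
-- initial segment, which in turn holds because Sk(M) contains, with each countable
-- ordinal, a ladder of it.  So, by density, an e ≥ ω · η in ω₁ has height at least η
-- in the generic tree.  If a condition forces ξ to lie on a level, then ξ has at
-- most ξ predecessors, so that level is bounded by ω · (ξ + 1), hence countable.

module Submission where

open import Defs
open import Level using (Lift; lift; lower) renaming (zero to 0ℓ; suc to lsuc)
open import Axiom.ExcludedMiddle using (ExcludedMiddle)
open import Data.Bool.Base using (true; false; T; if_then_else_)
open import Data.Empty using (⊥; ⊥-elim)
open import Data.Fin.Base using (zero; suc)
open import Data.Vec.Base using (Vec; []; _∷_)
open import Data.List.Base using (List; []; _∷_; map)
open import Data.List.Membership.Propositional using (_∈_; _∉_)
open import Data.List.Membership.Propositional.Properties using (∈-map⁺)
open import Data.List.Relation.Unary.All as All using ()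
open import Data.List.Relation.Unary.Any using (here; there)
open import Data.Nat.Base as ℕ using (ℕ; zero; suc; _+_; _*_)
import Data.Nat.Properties as ℕ
open import Data.Product.Base using (∃; _×_; _,_; proj₁; proj₂)
open import Data.Sum.Base using (_⊎_; inj₁; inj₂)
open import Function.Base using (case_of_)
open import Relation.Binary.Definitions using (tri<; tri≈; tri>)
open import Relation.Binary.PropositionalEquality using (_≡_; _≢_; refl; sym; trans; cong; subst)
open import Relation.Binary.Structures using (IsStrictTotalOrder)
open import Relation.Nullary.Decidable
  using (yes; no; map′; ⌊_⌋; recompute; decidable-stable; toWitness; fromWitness)
open import Relation.Nullary.Negation.Core using (¬_)
open import Induction.WellFounded using (Acc; acc)

-- Initiality of M ∩ ω₁ would follow from having in Sk(M) an enumeration of each countable ordinal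
-- of M, but functions and natural numbers would first have to be expressed in the language of `𝒜`.
-- A ladder is just a set of ordinals, describable by membership alone; the price is an induction
-- along the countable ordinals.
--
-- Heights live in the generic extension, where a level is indexed by a mere name α. They are never
-- evaluated in the ground model: two nodes forced onto the same level are compared by composing
-- their collapsing maps through α. Counting predecessors thereby becomes a descent through
-- ground-model ordinals, each step extending the current condition by a fresh node and then
-- deciding its image. The resulting bound depends on ξ alone and lies in the ground model, so an
-- injection of the level into ω can be named by restricting a ground-model one.

T-injective : ∀ {a b} → (T a → T b) → (T b → T a) → a ≡ b
T-injective {false} {false} _ _ = refl
T-injective {false} {true}  _ g = ⊥-elim (g _)
T-injective {true}  {false} f _ = ⊥-elim (f _)
T-injective {true}  {true}  _ _ = refl

-- Pairing natural numbers

pair : ℕ → ℕ → ℕ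
pair a b = (a + b) * (a + b) + a

square-gap : ∀ {s t a} c → a ℕ.≤ s → s ℕ.< t → s * s + a ℕ.< t * t + c
square-gap {s} {t} {a} c a≤s s<t = begin-strict
  s * s + a      ≤⟨ ℕ.+-monoʳ-≤ (s * s) a≤s ⟩
  s * s + s      ≡⟨ ℕ.+-comm (s * s) s ⟩
  suc s * s      <⟨ ℕ.*-monoʳ-< (suc s) (ℕ.n<1+n s) ⟩
  suc s * suc s  ≤⟨ ℕ.*-mono-≤ s<t s<t ⟩
  t * t          ≤⟨ ℕ.m≤m+n (t * t) c ⟩
  t * t + c      ∎
  where open ℕ.≤-Reasoning

-- Since a ≤ a + b, the value is at least (a + b)² and less than (a + b + 1)², so it determines a +
-- b; subtracting the square leaves a.
pair-injective : ∀ a b c d → pair a b ≡ pair c d → a ≡ c × b ≡ d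
pair-injective a b c d e with ℕ.<-cmp (a + b) (c + d)
... | tri< lt _ _ = ⊥-elim (ℕ.<⇒≢ (square-gap c (ℕ.m≤m+n a b) lt) e)
... | tri> _ _ gt = ⊥-elim (ℕ.<⇒≢ (square-gap a (ℕ.m≤m+n c d) gt) (sym e))
... | tri≈ _ s≡t _ with ℕ.+-cancelˡ-≡ ((a + b) * (a + b)) a c
                          (trans e (cong (λ t → t * t + c) (sym s≡t)))
... | refl = refl , ℕ.+-cancelˡ-≡ a b d s≡t

-- Countable ordinals

module OrdinalFacts (em : ExcludedMiddle 0ℓ) (Ω : Omega₂) where
  open Omega₂ Ω
  open IsStrictTotalOrder isStrictTotalOrder public
    using (compare) renaming (trans to <-trans; irrefl to <-irrefl; asym to <-asym)

  ≮⇒≥ : ∀ {α β} → ¬ (α < β) → β ≤ α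
  ≮⇒≥ {α} {β} α≮β with compare α β
  ... | tri< lt _ _ = ⊥-elim (α≮β lt)
  ... | tri≈ _ eq _ = inj₂ (sym eq)
  ... | tri> _ _ gt = inj₁ gt

  ≰⇒> : ∀ {α β} → ¬ (α ≤ β) → β < α
  ≰⇒> {α} {β} α≰β with compare α β
  ... | tri< lt _ _ = ⊥-elim (α≰β (inj₁ lt))
  ... | tri≈ _ eq _ = ⊥-elim (α≰β (inj₂ eq))
  ... | tri> _ _ gt = gt

  ≤-<-trans : ∀ {α β γ} → α ≤ β → β < γ → α < γ
  ≤-<-trans (inj₁ lt)   lt′ = <-trans lt lt′
  ≤-<-trans (inj₂ refl) lt′ = lt′

  <-≤-trans : ∀ {α β γ} → α < β → β ≤ γ → α < γ
  <-≤-trans lt (inj₁ lt′)  = <-trans lt lt′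
  <-≤-trans lt (inj₂ refl) = lt

  ≤⇒≯ : ∀ {α β} → α ≤ β → ¬ (β < α)
  ≤⇒≯ le lt = <-irrefl refl (≤-<-trans le lt)

  least : (P : Ord → Set) → ∀ {α} → P α → ∃ λ β → P β × (∀ γ → γ < β → ¬ P γ)
  least P {α} = go α (wellFounded α)
    where
    go : ∀ α → Acc _<_ α → P α → ∃ λ β → P β × (∀ γ → γ < β → ¬ P γ)
    go α (acc rs) Pα with em {∃ λ γ → γ < α × P γ}
    ... | yes (γ , γ<α , Pγ) = go γ (rs γ<α) Pγ
    ... | no none            = α , Pα , λ γ γ<α Pγ → none (γ , γ<α , Pγ)

  -- Regularity of ω₁: an unbounded sequence would cover ω₁ by countably many countable initial
  -- segments, and pairing a segment number with a position in that segment would count ω₁.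
  sequence-bounded : (g : ℕ → Ord) → (∀ n → g n < ω₁) →
                     ∃ λ β → β < ω₁ × (∀ n → g n < β)
  sequence-bounded g g<ω₁ with em {∃ λ β → β < ω₁ × (∀ n → g n < β)}
  ... | yes bounded  = bounded
  ... | no unbounded = ⊥-elim (ω₁-uncountable (code , code-injective))
    where
    position : ∀ ξ n → ξ ≤ g n → ℕ
    position ξ n (inj₁ _) = suc (proj₁ (<ω₁-countable (g n) (g<ω₁ n)) ξ)
    position ξ n (inj₂ _) = zero

    position-injective : ∀ ξ η n (p : ξ ≤ g n) (q : η ≤ g n) →
                         position ξ n p ≡ position η n q → ξ ≡ η
    position-injective ξ η n (inj₁ p) (inj₁ q) e =
      proj₂ (<ω₁-countable (g n) (g<ω₁ n)) ξ η p q (ℕ.suc-injective e)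
    position-injective ξ η n (inj₂ p) (inj₂ q) e = trans p (sym q)

    code : Ord → ℕ
    code ξ with em {∃ λ n → ξ ≤ g n}
    ... | yes (n , p) = pair n (position ξ n p)
    ... | no _        = zero

    code-injective : ∀ ξ η → ξ < ω₁ → η < ω₁ → code ξ ≡ code η → ξ ≡ η
    code-injective ξ η ξ<ω₁ η<ω₁ e
      with em {∃ λ n → ξ ≤ g n} | em {∃ λ n → η ≤ g n}
    ... | no none | _ = ⊥-elim (unbounded (ξ , ξ<ω₁ , λ n → ≰⇒> λ le → none (n , le)))
    ... | yes _ | no none = ⊥-elim (unbounded (η , η<ω₁ , λ n → ≰⇒> λ le → none (n , le)))
    ... | yes (n , p) | yes (m , q) with pair-injective n _ m _ e
    ... | refl , e′ = position-injective ξ η n p q e′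

  suc-below-ω₁ : ∀ {α} → α < ω₁ → ∃ λ β → β < ω₁ × α < β
  suc-below-ω₁ {α} α<ω₁ with sequence-bounded (λ _ → α) (λ _ → α<ω₁)
  ... | β , β<ω₁ , α<β = β , β<ω₁ , α<β zero

  increasing-mono : (g : ℕ → Ord) → (∀ n → g n < g (suc n)) →
                    ∀ {m n} → m ℕ.≤′ n → g m ≤ g n
  increasing-mono g g< ℕ.≤′-refl = inj₂ refl
  increasing-mono g g< (ℕ.≤′-step le) = inj₁ (≤-<-trans (increasing-mono g g< le) (g< _))

  increasing-avoids : (g : ℕ → Ord) → (∀ n → g n < g (suc n)) →
                      (l : List Ord) → ∃ λ N → ∀ n → N ℕ.≤ n → g n ∉ l
  increasing-avoids g g< [] = zero , λ _ _ ()
  increasing-avoids g g< (a ∷ l) with increasing-avoids g g< l | em {∃ λ m → g m ≡ a}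
  ... | N , avoids | no none = N , λ
    { n N≤n (here e)  → none (n , e)
    ; n N≤n (there i) → avoids n N≤n i }
  ... | N , avoids | yes (m , refl) = suc m ℕ.⊔ N , λ
    { n le (here e) → <-irrefl (sym e)
        (<-≤-trans (g< m) (increasing-mono g g< (ℕ.≤⇒≤′ (ℕ.≤-trans (ℕ.m≤m⊔n (suc m) N) le))))
    ; n le (there i) → avoids n (ℕ.≤-trans (ℕ.m≤n⊔m (suc m) N) le) i }

  -- β plays the part of α + ω: it bounds an increasing sequence starting at α, which no finite list
  -- can exhaust.
  infinite-interval : ∀ {α} → α < ω₁ → ∃ λ β → β < ω₁ ×
                      (∀ (l : List Ord) → ∃ λ δ → α ≤ δ × δ < β × δ ∉ l)
  infinite-interval {α} α<ω₁ = β , β<ω₁ , λ l →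
      let N , avoids = increasing-avoids (λ n → proj₁ (g n)) g-increasing l
      in proj₁ (g N) , increasing-mono _ g-increasing {n = N} (ℕ.≤⇒≤′ ℕ.z≤n) , g<β N ,
         avoids N ℕ.≤-refl
    where
    g : ℕ → ∃ λ β → β < ω₁
    g zero    = α , α<ω₁
    g (suc n) with suc-below-ω₁ (proj₂ (g n))
    ... | β , β<ω₁ , _ = β , β<ω₁

    g-increasing : ∀ n → proj₁ (g n) < proj₁ (g (suc n))
    g-increasing n = proj₂ (proj₂ (suc-below-ω₁ (proj₂ (g n))))

    bound = sequence-bounded (λ n → proj₁ (g n)) (λ n → proj₂ (g n))
    β = proj₁ bound
    β<ω₁ = proj₁ (proj₂ bound)
    g<β = proj₂ (proj₂ bound)

  -- A stand-in for ω · η ≤ ε: no matter which finitely many ordinals a condition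
  -- already uses, there is room for a chain of length η of fresh nodes below ε.
  data Large (η ε : Ord) : Set where
    large : (∀ ζ → ζ < η → (l : List Ord) → ∃ λ δ → δ < ε × δ ∉ l × Large ζ δ) →
            Large η ε

  -- By induction every ζ < η has a threshold, and as η is countable these thresholds have a common
  -- bound α below ω₁. An infinite interval above α then always contains a node that avoids the list
  -- and is ζ-large.
  eventually-large : ∀ {η} → η < ω₁ →
                     ∃ λ β → β < ω₁ × (∀ ε → β ≤ ε → Large η ε)
  eventually-large {η} = go η (wellFounded η)
    where
    go : ∀ η → Acc _<_ η → η < ω₁ → ∃ λ β → β < ω₁ × (∀ ε → β ≤ ε → Large η ε)
    go η (acc rs) η<ω₁ = β , β<ω₁ , λ ε β≤ε → large λ ζ ζ<η l →
        let δ , α≤δ , δ<β , δ∉l = interval l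
        in δ , <-≤-trans δ<β β≤ε , δ∉l , α-large ζ ζ<η δ α≤δ
      where
      index = <ω₁-countable η η<ω₁

      threshold : ℕ → ∃ λ β → β < ω₁
      threshold n with em {∃ λ ζ → ζ < η × proj₁ index ζ ≡ n}
      ... | yes (ζ , ζ<η , _) =
        let β , β<ω₁ , _ = go ζ (rs ζ<η) (<-trans ζ<η η<ω₁) in β , β<ω₁
      ... | no _ = η , η<ω₁

      threshold-large : ∀ ζ → ζ < η → ∀ ε → proj₁ (threshold (proj₁ index ζ)) ≤ ε → Large ζ ε
      threshold-large ζ ζ<η ε le with em {∃ λ ζ′ → ζ′ < η × proj₁ index ζ′ ≡ proj₁ index ζ}
      ... | no none = ⊥-elim (none (ζ , ζ<η , refl))
      ... | yes (ζ′ , ζ′<η , e) with proj₂ index ζ′ ζ ζ′<η ζ<η e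
      ... | refl = proj₂ (proj₂ (go ζ (rs ζ′<η) (<-trans ζ′<η η<ω₁))) ε le

      bound = sequence-bounded (λ n → proj₁ (threshold n)) (λ n → proj₂ (threshold n))
      α = proj₁ bound

      α-large : ∀ ζ → ζ < η → ∀ ε → α ≤ ε → Large ζ ε
      α-large ζ ζ<η ε α≤ε =
        threshold-large ζ ζ<η ε (inj₁ (<-≤-trans (proj₂ (proj₂ bound) _) α≤ε))

      above = infinite-interval (proj₁ (proj₂ bound))
      β = proj₁ above
      β<ω₁ = proj₁ (proj₂ above)
      interval = proj₂ (proj₂ above)

-- Elements of 𝒳 meet ω₁ in an initial segment

module HereditarySets (em : ExcludedMiddle 0ℓ) (S : Setting) where
  open Models S
  open OrdinalFacts em Ω

  ≈-refl : ∀ x → x ≈ x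
  ≈-refl (set β f) = (λ γ p → γ , p , ≈-refl (f γ p)) , (λ γ p → γ , p , ≈-refl (f γ p))

  ≈-sym : ∀ {x y} → x ≈ y → y ≈ x
  ≈-sym {set β f} {set δ g} (to , from) =
      (λ ε q → let γ , p , e = from ε q in γ , p , ≈-sym e)
    , (λ γ p → let ε , q , e = to γ p in ε , q , ≈-sym e)

  ≈-trans : ∀ {x y z} → x ≈ y → y ≈ z → x ≈ z
  ≈-trans {set β f} {set δ g} {set ζ h} (to , from) (to′ , from′) =
      (λ γ p → let ε , q , e = to γ p ; η , r , e′ = to′ ε q in η , r , ≈-trans e e′)
    , (λ η r → let ε , q , e′ = from′ η r ; γ , p , e = from ε q in γ , p , ≈-trans e e′)

  ∈ᴴ-respˡ : ∀ {x y z} → x ≈ y → x ∈ᴴ z → y ∈ᴴ z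
  ∈ᴴ-respˡ {z = set δ g} x≈y (ε , q , e) = ε , q , ≈-trans (≈-sym x≈y) e

  ∈ᴴ-respʳ : ∀ {x y z} → y ≈ z → x ∈ᴴ y → x ∈ᴴ z
  ∈ᴴ-respʳ {y = set _ _} {set _ _} (to , _) (γ , p , e) =
    let ε , q , e′ = to γ p in ε , q , ≈-trans e e′

  IsOrd-resp : ∀ {α x y} → x ≈ y → IsOrd α x → IsOrd α y
  IsOrd-resp {x = set _ _} {set _ _} (to , from) (cover , all) =
      (λ ξ ξ<α → let γ , p , o = cover ξ ξ<α ; ε , q , e = to γ p in ε , q , IsOrd-resp e o)
    , (λ ε q → let γ , p , e = from ε q ; ξ , ξ<α , o = all γ p in ξ , ξ<α , IsOrd-resp e o)

  IsOrd-≈ : ∀ {α x y} → IsOrd α x → IsOrd α y → x ≈ y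
  IsOrd-≈ {x = set _ _} {set _ _} (cover , all) (cover′ , all′) =
      (λ γ p → let ξ , ξ<α , o = all γ p ; ε , q , o′ = cover′ ξ ξ<α in ε , q , IsOrd-≈ o o′)
    , (λ ε q → let ξ , ξ<α , o′ = all′ ε q ; γ , p , o = cover ξ ξ<α in γ , p , IsOrd-≈ o o′)

  -- Mutual recursion on x: the element of x that represents ξ < α also represents some ξ′ < β, and
  -- uniqueness at this element gives ξ = ξ′.
  IsOrd-unique : ∀ {α β x} → IsOrd α x → IsOrd β x → α ≡ β
  IsOrd-< : ∀ {α β ξ} x → IsOrd α x → IsOrd β x → ξ < α → ξ < β

  IsOrd-unique {α} {β} {x} oα oβ with compare α β
  ... | tri< α<β _ _ = ⊥-elim (<-irrefl refl (IsOrd-< x oβ oα α<β))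
  ... | tri≈ _ α≡β _ = α≡β
  ... | tri> _ _ β<α = ⊥-elim (<-irrefl refl (IsOrd-< x oα oβ β<α))

  IsOrd-< (set δ f) (cover , _) (_ , all) ξ<α =
    let γ , p , o = cover _ ξ<α ; ξ′ , ξ′<β , o′ = all γ p
    in subst (_< _) (IsOrd-unique {x = f γ p} o′ o) ξ′<β

  ∈ᴴ⇒IsOrd : ∀ {β x y} → IsOrd β y → x ∈ᴴ y → ∃ λ α → α < β × IsOrd α x
  ∈ᴴ⇒IsOrd {y = set _ _} (_ , all) (ε , q , e) =
    let ξ , ξ<β , o = all ε q in ξ , ξ<β , IsOrd-resp (≈-sym e) o

  ∈ᴴ⇒< : ∀ {α β x y} → IsOrd α x → IsOrd β y → x ∈ᴴ y → α < β
  ∈ᴴ⇒< oα oβ x∈y = let _ , ξ<β , o = ∈ᴴ⇒IsOrd oβ x∈y in subst (_< _) (IsOrd-unique o oα) ξ<β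

  <⇒∈ᴴ : ∀ {α β x y} → IsOrd α x → IsOrd β y → α < β → x ∈ᴴ y
  <⇒∈ᴴ {y = set _ _} oα (cover , _) α<β =
    let ε , q , o = cover _ α<β in ε , q , IsOrd-≈ oα o

  ordAcc : ∀ α → Acc _<_ α → H
  ordAcc α (acc rs) = set α λ γ γ<α → ordAcc γ (rs (recompute (γ <? α) γ<α))

  IsOrd-ordAcc : ∀ α (a : Acc _<_ α) → IsOrd α (ordAcc α a)
  IsOrd-ordAcc α (acc rs) =
      (λ ξ ξ<α → ξ , ξ<α , IsOrd-ordAcc ξ (rs (recompute (ξ <? α) ξ<α)))
    , (λ γ γ<α → γ , γ<α , IsOrd-ordAcc γ (rs (recompute (γ <? α) γ<α)))

  ord : Ord → H
  ord α = ordAcc α (wellFounded α)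

  IsOrd-ord : ∀ α → IsOrd α (ord α)
  IsOrd-ord α = IsOrd-ordAcc α (wellFounded α)

  IsOrdSet-resp : ∀ {A x y} → x ≈ y → IsOrdSet A x → IsOrdSet A y
  IsOrdSet-resp x≈y (to , from) =
      (λ ξ Aξ → let z , z∈x , o = to ξ Aξ in z , ∈ᴴ-respʳ x≈y z∈x , o)
    , (λ z z∈y → from z (∈ᴴ-respʳ (≈-sym x≈y) z∈y))

  -- `set` is indexed by a whole initial segment, so indices outside A must be sent somewhere: they
  -- repeat the given element α of A.
  bounded-set : (A : Ord → Set) → ∀ {α β} → A α → (∀ ξ → A ξ → ξ < β) → ∃ (IsOrdSet A)
  bounded-set A {α} {β} Aα A<β = set β (λ γ _ → ord (element γ)) ,
      (λ ξ Aξ → ord ξ , (ξ , A<β ξ Aξ , element-≈ ξ Aξ) , IsOrd-ord ξ)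
    , (λ { y (γ , _ , e) →
           element γ , A-element γ , IsOrd-resp (≈-sym e) (IsOrd-ord (element γ)) })
    where
    element : Ord → Ord
    element γ with em {A γ}
    ... | yes _ = γ
    ... | no _  = α

    A-element : ∀ γ → A (element γ)
    A-element γ with em {A γ}
    ... | yes Aγ = Aγ
    ... | no _   = Aα

    element-≈ : ∀ γ → A γ → ord γ ≈ ord (element γ)
    element-≈ γ Aγ with em {A γ}
    ... | yes _  = ≈-refl (ord γ)
    ... | no ¬Aγ = ⊥-elim (¬Aγ Aγ)

  -- Surjectivity of π supplies an index, and the least index gives the Skolem value. As π reaches x
  -- only up to `≈`, the formula is required at every representative of x.
  skolem-value : ∀ {n} (φ : Formula (suc n)) (v : Vec H n) {x} →
                 (∀ {y} → y ≈ x → (y ∷ v) ⊨ φ) →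
                 ∃ λ y → ((y ∷ v) ⊨ φ) × IsSkolemValue φ v y
  skolem-value φ v {x} φ-x
    with least (λ ξ → (π ξ ∷ v) ⊨ φ) {proj₁ (proj₂ π-bijective x)}
               (φ-x (proj₂ (proj₂ π-bijective x) refl))
  ... | ξ , φ-πξ , ξ-least = π ξ , φ-πξ , ξ , ≈-refl (π ξ) , φ-πξ , ξ-least

  pattern x₀ = zero
  pattern x₁ = suc x₀
  pattern x₂ = suc x₁
  pattern x₃ = suc x₂

  -- The pair (s, y) satisfies this iff s ⊆ y is cofinal in y and, for every
  -- h < y, s ∩ h is empty or has a maximum.
  ladderᶠ : Formula 2
  ladderᶠ =
      (¬ᶠ (∃ᶠ ((x₀ ∈ᶠ x₁) ∧ᶠ (¬ᶠ (x₀ ∈ᶠ x₂)))))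
    ∧ᶠ ((¬ᶠ (∃ᶠ ((x₀ ∈ᶠ x₂) ∧ᶠ (¬ᶠ (∃ᶠ ((x₀ ∈ᶠ x₂) ∧ᶠ (¬ᶠ (x₀ ∈ᶠ x₁))))))))
    ∧ᶠ (¬ᶠ (∃ᶠ ((x₀ ∈ᶠ x₂) ∧ᶠ ((∃ᶠ ((x₀ ∈ᶠ x₂) ∧ᶠ (x₀ ∈ᶠ x₁)))
          ∧ᶠ (¬ᶠ (∃ᶠ ((x₀ ∈ᶠ x₂) ∧ᶠ ((x₀ ∈ᶠ x₁)
            ∧ᶠ (¬ᶠ (∃ᶠ ((x₀ ∈ᶠ x₃) ∧ᶠ ((x₀ ∈ᶠ x₂) ∧ᶠ (x₁ ∈ᶠ x₀))))))))))))))

  -- Classically, a cofinal subset of β of order type at most ω. The non-strict inequality in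
  -- `cofinal` admits successor ordinals β.
  record Ladder (A : Ord → Set) (β : Ord) : Set where
    field
      bounded : ∀ ξ → A ξ → ξ < β
      cofinal : ∀ ξ → ξ < β → ∃ λ ζ → A ζ × ξ ≤ ζ
      maximum : ∀ η ξ → η < β → A ξ → ξ < η →
                ∃ λ ζ → A ζ × ζ < η × (∀ ξ → A ξ → ξ < η → ξ ≤ ζ)

  ladder⇒⊨ : ∀ {A β s y} → Ladder A β → IsOrdSet A s → IsOrd β y →
             (s ∷ y ∷ []) ⊨ ladderᶠ
  ladder⇒⊨ {A} {β} {s} {y} L (to , from) oβ =
      (λ { (w , w∈s , w∉y) →
           let ξ , Aξ , oξ = from w w∈s in w∉y (<⇒∈ᴴ oξ oβ (bounded ξ Aξ)) })
    , (λ { (z , z∈y , none) →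
           let ξ , ξ<β , oξ = ∈ᴴ⇒IsOrd oβ z∈y
               ζ , Aζ , ξ≤ζ = cofinal ξ ξ<β
               w , w∈s , oζ = to ζ Aζ
           in none (w , w∈s , λ w∈z → ≤⇒≯ ξ≤ζ (∈ᴴ⇒< oζ oξ w∈z)) })
    , (λ { (h , h∈y , (u , u∈s , u∈h) , none) →
           let η , η<β , oη = ∈ᴴ⇒IsOrd oβ h∈y
               ξ , Aξ , oξ = from u u∈s
               ζ , Aζ , ζ<η , ζ-max = maximum η ξ η<β Aξ (∈ᴴ⇒< oξ oη u∈h)
               z , z∈s , oζ = to ζ Aζ
           in none (z , z∈s , <⇒∈ᴴ oζ oη ζ<η , λ { (w , w∈s , w∈h , z∈w) →
                let θ , Aθ , oθ = from w w∈s
                in ≤⇒≯ (ζ-max θ Aθ (∈ᴴ⇒< oθ oη w∈h)) (∈ᴴ⇒< oζ oθ z∈w) }) })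
    where open Ladder L

  -- The Skolem function may return another ladder than the one shown to exist, so its properties
  -- must be recovered from the formula. The first clause, s ⊆ y, makes every element of s an
  -- ordinal.
  ⊨⇒ladder : ∀ {β s y} → IsOrd β y → (s ∷ y ∷ []) ⊨ ladderᶠ →
             ∃ λ A → Ladder A β × IsOrdSet A s
  ⊨⇒ladder {β} {s} {y} oβ (bdd , cof , max) = A , record
    { bounded = λ { ξ (x , oξ , x∈s) → below ξ x oξ x∈s }
    ; cofinal = λ ξ ξ<β → decidable-stable em λ none →
        cof (ord ξ , <⇒∈ᴴ (IsOrd-ord ξ) oβ ξ<β , λ { (w , w∈s , w∉ξ) →
          let ζ , oζ = ordinal w w∈s
          in none (ζ , (w , oζ , w∈s) , ≮⇒≥ λ ζ<ξ → w∉ξ (<⇒∈ᴴ oζ (IsOrd-ord ξ) ζ<ξ)) })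
    ; maximum = λ { η ξ η<β (x , oξ , x∈s) ξ<η → decidable-stable em λ none →
        max (ord η , <⇒∈ᴴ (IsOrd-ord η) oβ η<β
            , (x , x∈s , <⇒∈ᴴ oξ (IsOrd-ord η) ξ<η)
            , λ { (z , z∈s , z∈η , z-max) →
                  let ζ , oζ = ordinal z z∈s
                  in none (ζ , (z , oζ , z∈s) , ∈ᴴ⇒< oζ (IsOrd-ord η) z∈η
                     , λ { θ (w , oθ , w∈s) θ<η → ≮⇒≥ λ ζ<θ →
                           z-max (w , w∈s , <⇒∈ᴴ oθ (IsOrd-ord η) θ<η , <⇒∈ᴴ oζ oθ ζ<θ) }) }) }
    } , (λ { ξ (x , oξ , x∈s) → x , x∈s , oξ })
      , (λ x x∈s → let ξ , oξ = ordinal x x∈s in ξ , (x , oξ , x∈s) , oξ)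
    where
    A : Ord → Set
    A ξ = ∃ λ x → IsOrd ξ x × x ∈ᴴ s

    ∈y : ∀ x → x ∈ᴴ s → x ∈ᴴ y
    ∈y x x∈s = decidable-stable em λ x∉y → bdd (x , x∈s , x∉y)

    ordinal : ∀ x → x ∈ᴴ s → ∃ λ ξ → IsOrd ξ x
    ordinal x x∈s = let ξ , _ , oξ = ∈ᴴ⇒IsOrd oβ (∈y x x∈s) in ξ , oξ

    below : ∀ ξ x → IsOrd ξ x → x ∈ᴴ s → ξ < β
    below ξ x oξ x∈s = ∈ᴴ⇒< oξ oβ (∈y x x∈s)

  -- Enumerate β in order type ω and keep the record values.
  ladder-exists : ∀ {β} → Countable (Below β) → ∃ λ A → Ladder A β
  ladder-exists {β} (f , f-inj) = A , record
    { bounded = λ _ → proj₁ ; cofinal = cof ; maximum = maxi }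
    where
    A : Ord → Set
    A ξ = ξ < β × (∀ υ → υ < β → f υ ℕ.< f ξ → υ < ξ)

    -- The member of [ξ, β) with least index is a record: whatever has smaller index lies below ξ.
    -- The bound n on the index makes the search terminate.
    first : ∀ n ξ → ξ < β → ∀ ζ → ξ ≤ ζ → ζ < β → f ζ ℕ.≤ n → ∃ λ ζ → A ζ × ξ ≤ ζ
    first n ξ ξ<β ζ ξ≤ζ ζ<β fζ≤n with em {∃ λ υ → ξ ≤ υ × υ < β × f υ ℕ.< f ζ}
    ... | no none = ζ , (ζ<β , λ υ υ<β fυ<fζ →
          <-≤-trans (≰⇒> λ ξ≤υ → none (υ , ξ≤υ , υ<β , fυ<fζ)) ξ≤ζ) , ξ≤ζ
    first zero    ξ ξ<β ζ ξ≤ζ ζ<β fζ≤n | yes (υ , ξ≤υ , υ<β , fυ<fζ)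
      with ℕ.<-≤-trans fυ<fζ fζ≤n
    ... | ()
    first (suc n) ξ ξ<β ζ ξ≤ζ ζ<β fζ≤n | yes (υ , ξ≤υ , υ<β , fυ<fζ) =
      first n ξ ξ<β υ ξ≤υ υ<β (ℕ.≤-pred (ℕ.<-≤-trans fυ<fζ fζ≤n))

    cof : ∀ ξ → ξ < β → ∃ λ ζ → A ζ × ξ ≤ ζ
    cof ξ ξ<β = first (f ξ) ξ ξ<β ξ (inj₂ refl) ξ<β ℕ.≤-refl

    f-mono : ∀ {ξ ζ} → A ξ → ζ < β → ξ < ζ → f ξ ℕ.< f ζ
    f-mono {ξ} {ζ} (ξ<β , record-ξ) ζ<β ξ<ζ with ℕ.<-cmp (f ξ) (f ζ)
    ... | tri< lt _ _ = lt
    ... | tri≈ _ e _ = ⊥-elim (<-irrefl (f-inj ξ ζ ξ<β ζ<β e) ξ<ζ)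
    ... | tri> _ _ gt = ⊥-elim (<-asym ξ<ζ (record-ξ ζ ζ<β gt))

    -- By `f-mono`, passing to a larger record below η raises its index, which stays below that of
    -- η; n bounds the number of steps left.
    last : ∀ n η → η < β → ∀ ζ → A ζ → ζ < η → f η ℕ.≤ f ζ + n →
           ∃ λ ζ → A ζ × ζ < η × (∀ ξ → A ξ → ξ < η → ξ ≤ ζ)
    last n η η<β ζ Aζ ζ<η le with em {∃ λ ξ → A ξ × ξ < η × ζ < ξ}
    ... | no none = ζ , Aζ , ζ<η , λ ξ Aξ ξ<η → ≮⇒≥ λ ζ<ξ → none (ξ , Aξ , ξ<η , ζ<ξ)
    last zero η η<β ζ Aζ ζ<η le | yes _ =
      ⊥-elim (ℕ.<⇒≱ (f-mono Aζ η<β ζ<η) (subst (f η ℕ.≤_) (ℕ.+-identityʳ (f ζ)) le))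
    last (suc n) η η<β ζ Aζ ζ<η le | yes (ξ , Aξ , ξ<η , ζ<ξ) =
      last n η η<β ξ Aξ ξ<η (ℕ.≤-trans le (ℕ.≤-trans (ℕ.≤-reflexive (ℕ.+-suc (f ζ) n))
        (ℕ.+-monoˡ-≤ n (f-mono Aζ (proj₁ Aξ) ζ<ξ))))

    maxi : ∀ η ξ → η < β → A ξ → ξ < η →
           ∃ λ ζ → A ζ × ζ < η × (∀ ξ → A ξ → ξ < η → ξ ≤ ζ)
    maxi η ξ η<β Aξ ξ<η = last (f η) η η<β ξ Aξ ξ<η (ℕ.m≤n+m (f η) (f ξ))

  elementᶠ : Formula 2
  elementᶠ = x₀ ∈ᶠ x₁

  aboveᶠ : Formula 3
  aboveᶠ = (x₀ ∈ᶠ x₁) ∧ᶠ (x₂ ∈ᶠ x₀)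

  -- Let η be the least ordinal missing from M, and suppose η < y ∈ M.  A ladder s
  -- of y lies in Sk(M), and so does the next element of s above max(s ∩ η); that
  -- element is an ordinal in [η, y), so by induction η ∈ M.
  𝒳-initial : ∀ {M} → 𝒳 M → ∀ {β ξ} → β < ω₁ → β ∈ₛ M → ξ < β → ξ ∈ₛ M
  𝒳-initial {M} (_ , sk-closed , _) {β} = go β (wellFounded β) _
    where
    Sk-M : H → Set
    Sk-M = Sk (ords (Mem M))

    Sk-ord : ∀ {ξ x} → ξ ∈ₛ M → IsOrd ξ x → Sk-M x
    Sk-ord {ξ} ξ∈M oξ = base (ξ , ξ∈M , oξ)

    ord-Sk : ∀ {ξ x} → IsOrd ξ x → Sk-M x → ξ ∈ₛ M
    ord-Sk {ξ} {x} oξ = proj₁ (sk-closed ξ x oξ)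

    go : ∀ β → Acc _<_ β → ∀ ξ → β < ω₁ → β ∈ₛ M → ξ < β → ξ ∈ₛ M
    go β (acc rs) ξ β<ω₁ β∈M ξ<β = decidable-stable em contradictory
      where
      contradictory : ¬ ¬ (ξ ∈ₛ M)
      contradictory ξ∉M = last-step
        where
        missing = least (λ ζ → ¬ (ζ ∈ₛ M)) ξ∉M
        η = proj₁ missing

        η∉M : ¬ (η ∈ₛ M)
        η∉M = proj₁ (proj₂ missing)

        below-η : ∀ ζ → ζ < η → ζ ∈ₛ M
        below-η ζ ζ<η = decidable-stable em (proj₂ (proj₂ missing) ζ ζ<η)

        η<β : η < β
        η<β = ≤-<-trans (≮⇒≥ λ ξ<η → ξ∉M (below-η ξ ξ<η)) ξ<β

        -- The only appeal to the induction hypothesis. With M ∩ β inside η, a contradiction arises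
        -- as soon as Sk(M) contains an element of s that is at least η.
        M∩β⊆η : ∀ ζ → ζ < β → ζ ∈ₛ M → ζ < η
        M∩β⊆η ζ ζ<β ζ∈M = ≰⇒> λ
          { (inj₁ η<ζ)  → η∉M (go ζ (rs ζ<β) η (<-trans ζ<β β<ω₁) ζ∈M η<ζ)
          ; (inj₂ refl) → η∉M ζ∈M }

        y : H
        y = ord β

        ladder = ladder-exists (<ω₁-countable β β<ω₁)
        ladder-top = Ladder.cofinal (proj₂ ladder) ξ ξ<β
        ladder-set = bounded-set (proj₁ ladder) (proj₁ (proj₂ ladder-top))
                                 (Ladder.bounded (proj₂ ladder))

        chosen = skolem-value ladderᶠ (y ∷ []) λ {s} s≈ →
          ladder⇒⊨ (proj₂ ladder) (IsOrdSet-resp (≈-sym s≈) (proj₂ ladder-set)) (IsOrd-ord β)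

        s : H
        s = proj₁ chosen

        s∈Sk : Sk-M s
        s∈Sk = skolem ladderᶠ (y ∷ []) (λ { zero → Sk-ord β∈M (IsOrd-ord β) })
                      (proj₂ (proj₂ chosen))

        decoded = ⊨⇒ladder {s = s} (IsOrd-ord β) (proj₁ (proj₂ chosen))
        A = proj₁ decoded
        s-codes-A : IsOrdSet A s
        s-codes-A = proj₂ (proj₂ decoded)
        open Ladder (proj₁ (proj₂ decoded))

        A∩M : ∀ {w} → w ∈ᴴ s → Sk-M w → ∃ λ ζ → A ζ × IsOrd ζ w × ζ < η
        A∩M {w} w∈s w∈Sk = let ζ , Aζ , oζ = proj₂ s-codes-A w w∈s in
          ζ , Aζ , oζ , M∩β⊆η ζ (bounded ζ Aζ) (ord-Sk oζ w∈Sk)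

        -- The maximum of s ∩ η exists only if s ∩ η is nonempty; the Skolem choice of an arbitrary
        -- element of s provides a member.
        some-below : ∃ λ ζ → A ζ × ζ < η
        some-below =
          let ζ , Aζ , _ = cofinal ξ ξ<β
              x , x∈s , _ = proj₁ s-codes-A ζ Aζ
              w , w∈s , sv = skolem-value elementᶠ (s ∷ []) (λ z≈x → ∈ᴴ-respˡ (≈-sym z≈x) x∈s)
              θ , Aθ , _ , θ<η = A∩M w∈s (skolem elementᶠ (s ∷ []) (λ { zero → s∈Sk }) sv)
          in θ , Aθ , θ<η

        last-step : ⊥
        last-step =
          let υ , Aυ , υ<η = some-below
              μ , Aμ , μ<η , μ-max = maximum η υ η<β Aυ υ<η
              ζ , Aζ , η≤ζ = cofinal η η<β
              x , x∈s , oζ = proj₁ s-codes-A ζ Aζ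
              z = ord μ
              oμ = IsOrd-ord μ
              -- The witness is the π-least element of s above μ, not necessarily the next one;
              -- maximality of μ puts every such element at or above η.
              w , (w∈s , z∈w) , sv = skolem-value aboveᶠ (s ∷ z ∷ []) λ v≈x →
                ∈ᴴ-respˡ (≈-sym v≈x) x∈s ,
                ∈ᴴ-respʳ (≈-sym v≈x) (<⇒∈ᴴ oμ oζ (<-≤-trans μ<η η≤ζ))
              θ , Aθ , oθ , θ<η = A∩M w∈s (skolem aboveᶠ (s ∷ z ∷ [])
                (λ { zero → s∈Sk ; (suc zero) → Sk-ord (below-η μ μ<η) oμ }) sv)
          in ≤⇒≯ (μ-max θ Aθ θ<η) (∈ᴴ⇒< oμ oθ z∈w)

-- Names

module ForcingFacts (P : Set) (_≤_ : P → P → Set)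
  (≤-refl : ∀ {p} → p ≤ p) (≤-trans : ∀ {p q r} → p ≤ q → q ≤ r → p ≤ r) where
  open Forcing P _≤_

  infix 4 _⊩_≈_ _⊩_∈_

  -- Unlike ≈̇ and ∈̇, which compute, the records let Agda infer the names.
  record _⊩_≈_ (p : P) (a b : Name) : Set where
    constructor eq
    field forces : (a ≈̇ b) p

  record _⊩_∈_ (p : P) (a b : Name) : Set where
    constructor el
    field forces : (a ∈̇ b) p

  Dense : P → (P → Set) → Set
  Dense p Q = ∀ q → q ≤ p → ∃ λ r → r ≤ q × Q r

  ≈-mono : ∀ {p q a b} → q ≤ p → p ⊩ a ≈ b → q ⊩ a ≈ b
  ≈-mono {a = name _ _ _} {name _ _ _} q≤p (eq (to , from)) =
    eq ((λ i r r≤q → to i r (≤-trans r≤q q≤p)) , (λ j r r≤q → from j r (≤-trans r≤q q≤p)))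

  ∈-mono : ∀ {p q a b} → q ≤ p → p ⊩ a ∈ b → q ⊩ a ∈ b
  ∈-mono {b = name _ _ _} q≤p (el a∈b) = el λ r r≤q → a∈b r (≤-trans r≤q q≤p)

  ∈-local : ∀ {p a b} → Dense p (λ r → r ⊩ a ∈ b) → p ⊩ a ∈ b
  ∈-local {b = name _ _ _} dense = el λ q q≤p →
    let r , r≤q , el a∈b = dense q q≤p
        r′ , r′≤r , found = a∈b r ≤-refl
    in r′ , ≤-trans r′≤r r≤q , found

  ≈-sym : ∀ {p a b} → p ⊩ a ≈ b → p ⊩ b ≈ a
  ≈-sym {a = name _ _ _} {name _ _ _} (eq (to , from)) = eq (from , to)

  ≈-local : ∀ {p a b} → Dense p (λ r → r ⊩ a ≈ b) → p ⊩ a ≈ b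
  ≈-local {p} {a@(name I x s)} {b@(name J y t)} dense = eq
    ( (λ i q q≤p q≤s → _⊩_∈_.forces {b = b} (∈-local λ q′ q′≤q →
         let r , r≤q′ , eq (to , _) = dense q′ (≤-trans q′≤q q≤p)
         in r , r≤q′ , el (to i r ≤-refl (≤-trans r≤q′ (≤-trans q′≤q q≤s)))))
    , (λ j q q≤p q≤t → _⊩_∈_.forces {b = a} (∈-local λ q′ q′≤q →
         let r , r≤q′ , eq (_ , from) = dense q′ (≤-trans q′≤q q≤p)
         in r , r≤q′ , el (from j r ≤-refl (≤-trans r≤q′ (≤-trans q′≤q q≤t))))) )

  ≈-refl : ∀ {p a} → p ⊩ a ≈ a
  ≈-refl {a = a} = eq (go a)
    where
    go : ∀ a {p} → (a ≈̇ a) p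
    go (name I x s) = side , side
      where
      side : ∀ i q → q ≤ _ → q ≤ s i → (x i ∈̇ name I x s) q
      side i q _ q≤s r r≤q = r , ≤-refl , i , ≤-trans r≤q q≤s , go (x i)

  ≈-trans : ∀ {p a b c} → p ⊩ a ≈ b → p ⊩ b ≈ c → p ⊩ a ≈ c
  ≈-trans {a = a} {b} {c} (eq a≈b) (eq b≈c) = eq (go a b c a≈b b≈c)
    where
    go : ∀ a b c {p} → (a ≈̇ b) p → (b ≈̇ c) p → (a ≈̇ c) p
    go (name I x s) (name J y t) (name K z u) (ab , ba) (bc , cb) =
        (λ i q q≤p q≤s q′ q′≤q →
           let r , r≤q′ , j , r≤t , xy = ab i q q≤p q≤s q′ q′≤q
               r′ , r′≤r , k , r′≤u , yz =
                 bc j r (≤-trans r≤q′ (≤-trans q′≤q q≤p)) r≤t r ≤-refl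
           in r′ , ≤-trans r′≤r r≤q′ , k , r′≤u ,
              go (x i) (y j) (z k) (mono (x i) (y j) r′≤r xy) yz)
      , (λ k q q≤p q≤u q′ q′≤q →
           let r , r≤q′ , j , r≤t , zy = cb k q q≤p q≤u q′ q′≤q
               r′ , r′≤r , i , r′≤s , yx =
                 ba j r (≤-trans r≤q′ (≤-trans q′≤q q≤p)) r≤t r ≤-refl
           in r′ , ≤-trans r′≤r r≤q′ , i , r′≤s ,
              go (z k) (y j) (x i) (mono (z k) (y j) r′≤r zy) yx)
      where
      mono : ∀ a b {q r} → r ≤ q → (a ≈̇ b) q → (a ≈̇ b) r
      mono a b r≤q h = _⊩_≈_.forces (≈-mono {a = a} {b} r≤q (eq h))

  ∈-respˡ : ∀ {p a b c} → p ⊩ a ≈ b → p ⊩ a ∈ c → p ⊩ b ∈ c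
  ∈-respˡ {a = a} {b} {name J y t} a≈b (el a∈c) = el λ q q≤p →
    let r , r≤q , j , r≤t , a≈y = a∈c q q≤p
    in r , r≤q , j , r≤t ,
       _⊩_≈_.forces {b = y j} (≈-trans (≈-sym (≈-mono (≤-trans r≤q q≤p) a≈b)) (eq a≈y))

  ∈-respʳ : ∀ {p a b c} → p ⊩ b ≈ c → p ⊩ a ∈ b → p ⊩ a ∈ c
  ∈-respʳ {a = a} {name J y t} {name K z u} (eq (to , _)) (el a∈b) = ∈-local λ q q≤p →
    let r , r≤q , j , r≤t , a≈y = a∈b q q≤p
    in r , r≤q , ∈-respˡ (≈-sym (eq a≈y)) (el (to j r (≤-trans r≤q q≤p) r≤t))

  ∈-element : ∀ {p I x s} i → p ≤ s i → p ⊩ x i ∈ name I x s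
  ∈-element {x = x} i p≤s = el λ q q≤p →
    q , ≤-refl , i , ≤-trans q≤p p≤s , _⊩_≈_.forces (≈-refl {a = x i})

  ∈-cases : ∀ {p a I x s} → p ⊩ a ∈ name I x s →
            Dense p (λ r → ∃ λ i → r ≤ s i × r ⊩ a ≈ x i)
  ∈-cases (el a∈) q q≤p =
    let r , r≤q , i , r≤s , a≈x = a∈ q q≤p in r , r≤q , i , r≤s , eq a≈x

  -- Foundation for names: if a ∈ a is forced, some extension identifies a with a constituent `x i`
  -- and hence forces `x i` ∈ `x i`, where `x i` is structurally smaller.
  ∈-irrefl : ∀ {p a} → ¬ (p ⊩ a ∈ a)
  ∈-irrefl {a = a} = go a
    where
    go : ∀ a {p} → ¬ (p ⊩ a ∈ a)
    go (name I x s) {p} a∈a =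
      let r , r≤p , i , r≤s , a≈xi = ∈-cases a∈a p ≤-refl
      in go (x i) (∈-respʳ a≈xi (∈-element i r≤s))

  ∈-setOf : ∀ {p I x} (i : I) → p ⊩ x i ∈ setOf I x
  ∈-setOf {p} {x = x} i = ∈-element {x = λ k → x (proj₁ k)} (i , p) ≤-refl

  ∈-setOf-cases : ∀ {p a I x} → p ⊩ a ∈ setOf I x → Dense p (λ r → ∃ λ i → r ⊩ a ≈ x i)
  ∈-setOf-cases a∈ q q≤p =
    let r , r≤q , (i , _) , _ , a≈x = ∈-cases a∈ q q≤p in r , r≤q , i , a≈x

  setOf-≈ : ∀ {p I J x y} → (∀ i → p ⊩ x i ∈ setOf J y) → (∀ j → p ⊩ y j ∈ setOf I x) →
            p ⊩ setOf I x ≈ setOf J y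
  setOf-≈ to from = eq
    ( (λ { (i , _) q q≤p _ → _⊩_∈_.forces (∈-mono q≤p (to i)) })
    , (λ { (j , _) q q≤p _ → _⊩_∈_.forces (∈-mono q≤p (from j)) }) )

  ∈-upairˡ : ∀ {p a b} → p ⊩ a ∈ upair a b
  ∈-upairˡ {a = a} {b} = ∈-setOf {x = λ i → if i then a else b} true

  ∈-upairʳ : ∀ {p a b} → p ⊩ b ∈ upair a b
  ∈-upairʳ {a = a} {b} = ∈-setOf {x = λ i → if i then a else b} false

  ∈-upair-cases : ∀ {p z a b} → p ⊩ z ∈ upair a b → Dense p (λ r → r ⊩ z ≈ a ⊎ r ⊩ z ≈ b)
  ∈-upair-cases z∈ q q≤p with ∈-setOf-cases z∈ q q≤p
  ... | r , r≤q , true  , z≈a = r , r≤q , inj₁ z≈a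
  ... | r , r≤q , false , z≈b = r , r≤q , inj₂ z≈b

  upair-cong : ∀ {p a b c d} → p ⊩ a ≈ c → p ⊩ b ≈ d → p ⊩ upair a b ≈ upair c d
  upair-cong a≈c b≈d = setOf-≈
    (λ { true → ∈-respˡ (≈-sym a≈c) ∈-upairˡ ; false → ∈-respˡ (≈-sym b≈d) ∈-upairʳ })
    (λ { true → ∈-respˡ a≈c ∈-upairˡ ; false → ∈-respˡ b≈d ∈-upairʳ })

  opair-cong : ∀ {p a b c d} → p ⊩ a ≈ c → p ⊩ b ≈ d → p ⊩ opair a b ≈ opair c d
  opair-cong a≈c b≈d = upair-cong (upair-cong a≈c a≈c) (upair-cong a≈c b≈d)

  ∈-singleton : ∀ {p z a} → p ⊩ z ∈ upair a a → p ⊩ z ≈ a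
  ∈-singleton z∈ = ≈-local λ q q≤p → case ∈-upair-cases z∈ q q≤p of λ
    { (r , r≤q , inj₁ z≈a) → r , r≤q , z≈a
    ; (r , r≤q , inj₂ z≈a) → r , r≤q , z≈a }

  opair-injectiveˡ : ∀ {p a b c d} → p ⊩ opair a b ≈ opair c d → p ⊩ a ≈ c
  opair-injectiveˡ e = ≈-local λ q q≤p →
    case ∈-upair-cases (∈-respʳ e ∈-upairˡ) q q≤p of λ
    { (r , r≤q , inj₁ aa≈cc) → r , r≤q , ∈-singleton (∈-respʳ aa≈cc ∈-upairˡ)
    ; (r , r≤q , inj₂ aa≈cd) → r , r≤q , ≈-sym (∈-singleton (∈-respʳ (≈-sym aa≈cd) ∈-upairˡ)) }

  opair-second : ∀ {p a b c d} → p ⊩ opair a b ≈ opair c d →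
                 Dense p (λ r → r ⊩ b ≈ d ⊎ r ⊩ b ≈ a)
  opair-second e q q≤p with ∈-upair-cases (∈-respʳ e ∈-upairʳ) q q≤p
  ... | r , r≤q , inj₁ ab≈cc = r , r≤q ,
        inj₂ (≈-trans (∈-singleton (∈-respʳ ab≈cc ∈-upairʳ))
                      (≈-sym (∈-singleton (∈-respʳ ab≈cc ∈-upairˡ))))
  ... | r , r≤q , inj₂ ab≈cd with ∈-upair-cases (∈-respʳ ab≈cd ∈-upairʳ) r ≤-refl
  ... | r′ , r′≤r , inj₂ b≈d = r′ , ≤-trans r′≤r r≤q , inj₁ b≈d
  ... | r′ , r′≤r , inj₁ b≈c = r′ , r′≤q , inj₂ (≈-trans b≈c
        (≈-sym (opair-injectiveˡ (≈-mono (≤-trans r′≤q q≤p) e))))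
    where r′≤q = ≤-trans r′≤r r≤q

  -- If b = a, the dichotomy of `opair-second` read backwards gives d = b or d = c, and in the
  -- latter case b = a = c = d.
  opair-injectiveʳ : ∀ {p a b c d} → p ⊩ opair a b ≈ opair c d → p ⊩ b ≈ d
  opair-injectiveʳ e = ≈-local λ q q≤p → case opair-second e q q≤p of λ
    { (r , r≤q , inj₁ b≈d) → r , r≤q , b≈d
    ; (r , r≤q , inj₂ b≈a) →
      let e′ = ≈-mono (≤-trans r≤q q≤p) e
      in case opair-second (≈-sym e′) r ≤-refl of λ
      { (r′ , r′≤r , inj₁ d≈b) → r′ , ≤-trans r′≤r r≤q , ≈-sym d≈b
      ; (r′ , r′≤r , inj₂ d≈c) → r′ , ≤-trans r′≤r r≤q ,
          ≈-trans (≈-mono r′≤r (≈-trans b≈a (opair-injectiveˡ e′))) (≈-sym d≈c) } }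

  ∈-succ : ∀ {p} a → p ⊩ a ∈ succ a
  ∈-succ {p} (name I x s) = ∈-element (inj₂ p) ≤-refl

  ∈-succ-⊇ : ∀ {p z} a → p ⊩ z ∈ a → p ⊩ z ∈ succ a
  ∈-succ-⊇ a@(name I x s) z∈a = ∈-local λ q q≤p →
    let r , r≤q , i , r≤s , z≈x = ∈-cases z∈a q q≤p
    in r , r≤q , ∈-respˡ (≈-sym z≈x) (∈-element (inj₁ i) r≤s)

  numeral-∈ : ∀ {p m n} → m ℕ.<′ n → p ⊩ numeral m ∈ numeral n
  numeral-∈ {m = m} (ℕ.<′-base)    = ∈-succ (numeral m)
  numeral-∈ {n = suc n} (ℕ.<′-step m<n) = ∈-succ-⊇ (numeral n) (numeral-∈ m<n)

  numeral-injective : ∀ {p} m n → p ⊩ numeral m ≈ numeral n → m ≡ n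
  numeral-injective m n e with ℕ.<-cmp m n
  ... | tri≈ _ m≡n _ = m≡n
  ... | tri< m<n _ _ = ⊥-elim (∈-irrefl (∈-respʳ (≈-sym e) (numeral-∈ (ℕ.<⇒<′ m<n))))
  ... | tri> _ _ n<m = ⊥-elim (∈-irrefl (∈-respʳ e (numeral-∈ (ℕ.<⇒<′ n<m))))

-- Extending conditions

module Extensions (em : ExcludedMiddle 0ℓ) (S : Setting) (Γ : Setting.Ord S → Set) where
  open GenericTree S Γ
  open FiniteTree
  open OrdinalFacts em Ω
  open HereditarySets em S using (𝒳-initial)

  ≐-refl : ∀ {M} → M ≐ M
  ≐-refl _ = refl

  ⊑-≺ : ∀ {q p a b} → q ⊑ p → _≺_ (tree p) a b → _≺_ (tree q) a b
  ⊑-≺ {p = p} {a} {b} ((_ , lt-agrees) , _) a≺b =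
    let a∈ , b∈ = ≺-nodes (tree p) a b a≺b in subst T (sym (lt-agrees a b a∈ b∈)) a≺b

  ≼ᵀ-trans : ∀ (t : FiniteTree Ω) {a b c} → _≼ᵀ_ t a b → _≼ᵀ_ t b c → _≼ᵀ_ t a c
  ≼ᵀ-trans t (inj₁ a≺b)  (inj₁ b≺c)  = inj₁ (≺-trans t _ _ _ a≺b b≺c)
  ≼ᵀ-trans t (inj₁ a≺b)  (inj₂ refl) = inj₁ a≺b
  ≼ᵀ-trans t (inj₂ refl) b≼c         = b≼c

  ⊑-refl : ∀ {p} → p ⊑ p
  ⊑-refl = ((λ _ a∈ → a∈) , (λ _ _ _ _ → refl))
         , (λ M M∈ → M , M∈ , ≐-refl {M})
         , (λ a a-max → a , a-max , inj₂ refl , refl)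

  ⊑-trans : ∀ {p q r} → p ⊑ q → q ⊑ r → p ⊑ r
  ⊑-trans {p} {q} p⊑q@((⊇₁ , lt₁) , side₁ , max₁) ((⊇₂ , lt₂) , side₂ , max₂) =
      ( (λ a a∈ → ⊇₁ a (⊇₂ a a∈))
      , (λ a b a∈ b∈ → trans (lt₁ a b (⊇₂ a a∈) (⊇₂ b b∈)) (lt₂ a b a∈ b∈)))
    , (λ M M∈ → let N , N∈ , M≐N = side₂ M M∈ ; K , K∈ , N≐K = side₁ N N∈
                in K , K∈ , λ ξ → trans (M≐N ξ) (N≐K ξ))
    , (λ a a-max →
         let b , b-max , a≼b , Fa≡Fb = max₂ a a-max
             c , c-max , b≼c , Fb≡Fc = max₁ b b-max
         in c , c-max , ≼ᵀ-trans (tree p) (lift-≼ a≼b) b≼c , trans Fa≡Fb Fb≡Fc)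
    where
    lift-≼ : ∀ {a b} → _≼ᵀ_ (tree q) a b → _≼ᵀ_ (tree p) a b
    lift-≼ (inj₁ a≺b)  = inj₁ (⊑-≺ {p} {q} p⊑q a≺b)
    lift-≼ (inj₂ refl) = inj₂ refl

  ≺⇒<ω₁ : ∀ (t : FiniteTree Ω) {a b} → _≺_ t a b → a < ω₁
  ≺⇒<ω₁ t a≺b = nodes-<ω₁ t _ (proj₁ (≺-nodes t _ _ a≺b))

  -- A missing e is added as an isolated node, so clause (4) gains no instance: nothing lies below
  -- it. Being maximal, it needs a value of F outside the finitely many old ones.
  add-node : ∀ p {e} → e < ω₁ → ∃ λ q → q ⊑ p × e ∈ nodes (tree q)
  add-node p {e} e<ω₁ with em {e ∈ nodes (tree p)}
  ... | yes e∈ = p , ⊑-refl {p} , e∈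
  ... | no e∉ = q , (((λ _ → there) , (λ _ _ _ _ → refl)) , (λ M M∈ → M , M∈ , ≐-refl {M})
                    , λ a a-max → a , max⁺ a-max , inj₂ refl , sym (F′-old (old a-max))) , here refl
    where
    t = tree p

    t′ : FiniteTree Ω
    t′ = record
      { nodes     = e ∷ nodes t
      ; lt        = lt t
      ; nodes-<ω₁ = λ { _ (here refl) → e<ω₁ ; a (there a∈) → nodes-<ω₁ t a a∈ }
      ; ≺-nodes   = λ a b a≺b → let a∈ , b∈ = ≺-nodes t a b a≺b in there a∈ , there b∈
      ; ≺-irrefl  = ≺-irrefl t
      ; ≺-trans   = ≺-trans t
      ; ≺-linear  = ≺-linear t
      ; ≺⇒<       = ≺⇒< t
      }

    old : ∀ {a} → IsMaximal t a → a ≢ e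
    old (a∈ , _) refl = e∉ a∈

    max⁺ : ∀ {a} → IsMaximal t a → IsMaximal t′ a
    max⁺ (a∈ , a-max) = there a∈ , a-max

    max⁻ : ∀ {a} → IsMaximal t′ a → a ≡ e ⊎ IsMaximal t a
    max⁻ (here a≡e , _)       = inj₁ a≡e
    max⁻ (there a∈ , a-max) = inj₂ (a∈ , a-max)

    unused = proj₂ (proj₂ (infinite-interval e<ω₁)) (map (F p) (nodes t))
    fresh = proj₁ unused

    fresh∉ : ∀ {a} → IsMaximal t a → F p a ≢ fresh
    fresh∉ (a∈ , _) Fa≡fresh = proj₂ (proj₂ (proj₂ unused))
      (subst (_∈ map (F p) (nodes t)) Fa≡fresh (∈-map⁺ (F p) a∈))

    F′ : Ord → Ord
    F′ a with em {a ≡ e}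
    ... | yes _ = fresh
    ... | no _  = F p a

    F′-e : F′ e ≡ fresh
    F′-e with em {e ≡ e}
    ... | yes _  = refl
    ... | no e≢e = ⊥-elim (e≢e refl)

    F′-old : ∀ {a} → a ≢ e → F′ a ≡ F p a
    F′-old {a} a≢e with em {a ≡ e}
    ... | yes a≡e = ⊥-elim (a≢e a≡e)
    ... | no _    = refl

    F′-injective : ∀ a b → IsMaximal t′ a → IsMaximal t′ b → F′ a ≡ F′ b → a ≡ b
    F′-injective a b a-max b-max F≡ with max⁻ a-max | max⁻ b-max
    ... | inj₁ refl | inj₁ refl = refl
    ... | inj₁ refl | inj₂ b-old = ⊥-elim (fresh∉ b-old
            (trans (sym (F′-old (old b-old))) (trans (sym F≡) F′-e)))
    ... | inj₂ a-old | inj₁ refl = ⊥-elim (fresh∉ a-old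
            (trans (sym (F′-old (old a-old))) (trans F≡ F′-e)))
    ... | inj₂ a-old | inj₂ b-old = F-injective p a b a-old b-old
            (trans (sym (F′-old (old a-old))) (trans F≡ (F′-old (old b-old))))

    old-max : ∀ {a c} → IsMaximal t′ a → _≺_ t c a → IsMaximal t a
    old-max (_ , a-max) c≺a = proj₂ (≺-nodes t _ _ c≺a) , a-max

    q : Condition
    q = record
      { tree        = t′
      ; F           = F′
      ; side        = side p
      ; F-injective = F′-injective
      ; adequate    = adequate p
      ; closed      = λ M a b c M∈ a-max b-max a≢b Fa∈M Fb∈M c≺a c≺b →
          let a-old = old-max a-max c≺a ; b-old = old-max b-max c≺b
          in closed p M a b c M∈ a-old b-old a≢b
               (subst (_∈ₛ M) (F′-old (old a-old)) Fa∈M)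
               (subst (_∈ₛ M) (F′-old (old b-old)) Fb∈M) c≺a c≺b
      }

  -- The new node d lies above the predecessors of e that are smaller than d and
  -- below everything else that is comparable with e.  Clause (4) at d follows from
  -- clause (4) at the successor y > d of d, because M ∩ ω₁ is an initial segment.
  insert-below : ∀ p {e d} → e ∈ nodes (tree p) → d < e → d ∉ nodes (tree p) →
                 ∃ λ q → q ⊑ p × _≺_ (tree q) d e
  insert-below p {e} {d} e∈ d<e d∉ =
      q , (((λ _ → there) , λ a b a∈ b∈ → T-injective (old⁻ a∈ b∈) old⁺)
          , (λ M M∈ → M , M∈ , ≐-refl {M})
          , λ a a-max → a , max⁺ a-max , inj₂ refl , refl)
        , fromWitness (below refl (e , inj₂ refl , d<e , inj₂ refl))
    where
    t = tree p
    open FiniteTree t using () renaming (_≺_ to _≺₀_; _≼ᵀ_ to _≼₀_)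

    -- y lies on the path to e, with e included, and exceeds d. A node b above y may leave that path
    -- before e, yet transitivity puts d below it as well.
    AboveNew : Ord → Set
    AboveNew b = ∃ λ y → y ≼₀ e × d < y × y ≼₀ b

    data _≺₁_ (a b : Ord) : Set where
      keep  : a ≺₀ b → a ≺₁ b
      above : b ≡ d → a ≺₀ e → a < d → a ≺₁ b
      below : a ≡ d → AboveNew b → a ≺₁ b

    ≼⇒≤ : ∀ {a b} → a ≼₀ b → a ≤ b
    ≼⇒≤ (inj₁ a≺b) = inj₁ (≺⇒< t _ _ a≺b)
    ≼⇒≤ (inj₂ a≡b) = inj₂ a≡b

    ≺-≼-trans : ∀ {a b c} → a ≺₀ b → b ≼₀ c → a ≺₀ c
    ≺-≼-trans a≺b (inj₁ b≺c)  = ≺-trans t _ _ _ a≺b b≺c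
    ≺-≼-trans a≺b (inj₂ refl) = a≺b

    ≼-node : ∀ {a b} → a ≼₀ b → b ∈ nodes t → a ∈ nodes t
    ≼-node (inj₁ a≺b)  _  = proj₁ (≺-nodes t _ _ a≺b)
    ≼-node (inj₂ refl) b∈ = b∈

    aboveNew-node : ∀ {b} → AboveNew b → b ∈ nodes t
    aboveNew-node (y , y≼e , _ , inj₁ y≺b)  = proj₂ (≺-nodes t _ _ y≺b)
    aboveNew-node (y , y≼e , _ , inj₂ refl) = ≼-node y≼e e∈

    aboveNew-> : ∀ {b} → AboveNew b → d < b
    aboveNew-> (y , _ , d<y , y≼b) = <-≤-trans d<y (≼⇒≤ y≼b)

    d⊀ : ∀ {b} → ¬ (d ≺₀ b)
    d⊀ d≺b = d∉ (proj₁ (≺-nodes t _ _ d≺b))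

    ⊀d : ∀ {a} → ¬ (a ≺₀ d)
    ⊀d a≺d = d∉ (proj₂ (≺-nodes t _ _ a≺d))

    irrefl : ∀ a → ¬ (a ≺₁ a)
    irrefl a (keep a≺a)         = ≺-irrefl t a a≺a
    irrefl a (above refl d≺e _) = d⊀ d≺e
    irrefl a (below refl d-new) = d∉ (aboveNew-node d-new)

    ≺₁-trans : ∀ {a b c} → a ≺₁ b → b ≺₁ c → a ≺₁ c
    ≺₁-trans (keep a≺b) (keep b≺c) = keep (≺-trans t _ _ _ a≺b b≺c)
    ≺₁-trans (keep a≺b) (above refl b≺e b<d) =
      above refl (≺-trans t _ _ _ a≺b b≺e) (<-trans (≺⇒< t _ _ a≺b) b<d)
    ≺₁-trans (keep a≺d) (below refl _) = ⊥-elim (⊀d a≺d)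
    ≺₁-trans (above refl _ _) (keep d≺c) = ⊥-elim (d⊀ d≺c)
    ≺₁-trans (above refl _ _) (above refl d≺e _) = ⊥-elim (d⊀ d≺e)
    ≺₁-trans {a} (above refl a≺e a<d) (below refl (y , y≼e , d<y , y≼c)) =
      keep (below-y y≼e y≼c)
      where
      below-y : ∀ {c} → y ≼₀ e → y ≼₀ c → a ≺₀ c
      below-y (inj₂ refl) y≼c = ≺-≼-trans a≺e y≼c
      below-y (inj₁ y≺e) y≼c with ≺-linear t a y e a≺e y≺e
      ... | inj₁ refl       = ⊥-elim (<-asym a<d d<y)
      ... | inj₂ (inj₁ a≺y) = ≺-≼-trans a≺y y≼c
      ... | inj₂ (inj₂ y≺a) = ⊥-elim (<-asym a<d (<-trans d<y (≺⇒< t _ _ y≺a)))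
    ≺₁-trans (below refl (y , y≼e , d<y , y≼b)) (keep b≺c) =
      below refl (y , y≼e , d<y , ≼ᵀ-trans t y≼b (inj₁ b≺c))
    ≺₁-trans (below refl b-new) (above refl _ b<d) = ⊥-elim (<-asym b<d (aboveNew-> b-new))
    ≺₁-trans (below refl d-new) (below refl _) = ⊥-elim (d∉ (aboveNew-node d-new))

    -- Both a and the witness y lie at or below c, hence are comparable. At or beyond y, a is above
    -- d; otherwise a lies on the path to e, where comparing a and d as ordinals places it.
    compare-with-d : ∀ {a c} → a ≺₀ c → AboveNew c → a ≡ d ⊎ a ≺₁ d ⊎ d ≺₁ a
    compare-with-d {a} {c} a≺c (y , y≼e , d<y , y≼c) = place y≼c
      where
      from-≺e : a ≺₀ e → a ≡ d ⊎ a ≺₁ d ⊎ d ≺₁ a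
      from-≺e a≺e with compare a d
      ... | tri< a<d _ _ = inj₂ (inj₁ (above refl a≺e a<d))
      ... | tri≈ _ a≡d _ = inj₁ a≡d
      ... | tri> _ _ d<a = inj₂ (inj₂ (below refl (a , inj₁ a≺e , d<a , inj₂ refl)))

      place : y ≼₀ c → a ≡ d ⊎ a ≺₁ d ⊎ d ≺₁ a
      place (inj₂ refl) = from-≺e (≺-≼-trans a≺c y≼e)
      place (inj₁ y≺c) with ≺-linear t a y c a≺c y≺c
      ... | inj₁ refl       = inj₂ (inj₂ (below refl (y , y≼e , d<y , inj₂ refl)))
      ... | inj₂ (inj₁ a≺y) = from-≺e (≺-≼-trans a≺y y≼e)
      ... | inj₂ (inj₂ y≺a) = inj₂ (inj₂ (below refl (y , y≼e , d<y , inj₁ y≺a)))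

    keep-linear : ∀ {a b c} → a ≺₀ c → b ≺₀ c → a ≡ b ⊎ a ≺₁ b ⊎ b ≺₁ a
    keep-linear a≺c b≺c with ≺-linear t _ _ _ a≺c b≺c
    ... | inj₁ a≡b        = inj₁ a≡b
    ... | inj₂ (inj₁ a≺b) = inj₂ (inj₁ (keep a≺b))
    ... | inj₂ (inj₂ b≺a) = inj₂ (inj₂ (keep b≺a))

    linear : ∀ {a b c} → a ≺₁ c → b ≺₁ c → a ≡ b ⊎ a ≺₁ b ⊎ b ≺₁ a
    linear (keep a≺c) (keep b≺c) = keep-linear a≺c b≺c
    linear (keep a≺d) (above refl _ _) = ⊥-elim (⊀d a≺d)
    linear (keep a≺c) (below refl c-new) = compare-with-d a≺c c-new
    linear (above refl _ _) (keep b≺d) = ⊥-elim (⊀d b≺d)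
    linear (above refl a≺e _) (above _ b≺e _) = keep-linear a≺e b≺e
    linear (above refl _ _) (below refl d-new) = ⊥-elim (d∉ (aboveNew-node d-new))
    linear (below refl c-new) (keep b≺c) with compare-with-d b≺c c-new
    ... | inj₁ refl       = inj₁ refl
    ... | inj₂ (inj₁ b≺d) = inj₂ (inj₂ b≺d)
    ... | inj₂ (inj₂ d≺b) = inj₂ (inj₁ d≺b)
    linear (below refl d-new) (above refl _ _) = ⊥-elim (d∉ (aboveNew-node d-new))
    linear (below refl _) (below refl _) = inj₁ refl

    ≺₁⇒< : ∀ {a b} → a ≺₁ b → a < b
    ≺₁⇒< (keep a≺b)         = ≺⇒< t _ _ a≺b
    ≺₁⇒< (above refl _ a<d) = a<d
    ≺₁⇒< (below refl b-new) = aboveNew-> b-new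

    ≺₁-nodes : ∀ {a b} → a ≺₁ b → a ∈ d ∷ nodes t × b ∈ d ∷ nodes t
    ≺₁-nodes (keep a≺b) = let a∈ , b∈ = ≺-nodes t _ _ a≺b in there a∈ , there b∈
    ≺₁-nodes (above refl a≺e _) = there (proj₁ (≺-nodes t _ _ a≺e)) , here refl
    ≺₁-nodes (below refl b-new) = here refl , there (aboveNew-node b-new)

    t′ : FiniteTree Ω
    t′ = record
      { nodes     = d ∷ nodes t
      ; lt        = λ a b → ⌊ em {a ≺₁ b} ⌋
      ; nodes-<ω₁ = λ
          { _ (here refl) → <-trans d<e (nodes-<ω₁ t e e∈)
          ; a (there a∈)  → nodes-<ω₁ t a a∈ }
      ; ≺-nodes   = λ a b a≺b → ≺₁-nodes (toWitness a≺b)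
      ; ≺-irrefl  = λ a a≺a → irrefl a (toWitness a≺a)
      ; ≺-trans   = λ a b c a≺b b≺c → fromWitness (≺₁-trans (toWitness a≺b) (toWitness b≺c))
      ; ≺-linear  = λ a b c a≺c b≺c → case linear (toWitness a≺c) (toWitness b≺c) of λ
          { (inj₁ a≡b)        → inj₁ a≡b
          ; (inj₂ (inj₁ a≺b)) → inj₂ (inj₁ (fromWitness a≺b))
          ; (inj₂ (inj₂ b≺a)) → inj₂ (inj₂ (fromWitness b≺a)) }
      ; ≺⇒<       = λ a b a≺b → ≺₁⇒< (toWitness a≺b)
      }

    old⁺ : ∀ {a b} → a ≺₀ b → _≺_ t′ a b
    old⁺ a≺b = fromWitness (keep a≺b)

    old⁻ : ∀ {a b} → a ∈ nodes t → b ∈ nodes t → _≺_ t′ a b → a ≺₀ b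
    old⁻ {a} {b} a∈ b∈ a≺b with toWitness {a? = em {a ≺₁ b}} a≺b
    ... | keep a≺₀b      = a≺₀b
    ... | above refl _ _ = ⊥-elim (d∉ b∈)
    ... | below refl _   = ⊥-elim (d∉ a∈)

    -- The maximal nodes stay the same, so F is kept: d lies below e, and an old node below d was
    -- already below e.
    max⁺ : ∀ {a} → IsMaximal t a → IsMaximal t′ a
    max⁺ {a} (a∈ , a-max) = there a∈ , λ b a≺b → case toWitness {a? = em {a ≺₁ b}} a≺b of λ
      { (keep a≺₀b)       → a-max b a≺₀b
      ; (above _ a≺e _) → a-max e a≺e
      ; (below refl _)  → d∉ a∈ }

    max⁻ : ∀ {a} → IsMaximal t′ a → IsMaximal t a
    max⁻ (there a∈ , a-max) = a∈ , λ b a≺b → a-max b (old⁺ a≺b)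
    max⁻ (here refl , a-max) =
      ⊥-elim (a-max e (fromWitness (below refl (e , inj₂ refl , d<e , inj₂ refl))))

    branching : ∀ {a b} → IsMaximal t a → IsMaximal t b → a ≢ b →
                ∀ {y} → y ≼₀ a → y ≼₀ b → y ≺₀ a × y ≺₀ b
    branching _ _ _ (inj₁ y≺a) (inj₁ y≺b) = y≺a , y≺b
    branching _ (_ , b-max) _ (inj₁ b≺a) (inj₂ refl) = ⊥-elim (b-max _ b≺a)
    branching (_ , a-max) _ _ (inj₂ refl) (inj₁ a≺b) = ⊥-elim (a-max _ a≺b)
    branching _ _ a≢b (inj₂ refl) (inj₂ refl) = ⊥-elim (a≢b refl)

    -- The two witnesses lie on the path to e; the lower one is below both a and b and still exceeds
    -- d.
    common : ∀ {a b} → AboveNew a → AboveNew b → ∃ λ y → d < y × y ≼₀ a × y ≼₀ b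
    common (y , y≼e , d<y , y≼a) (z , z≼e , d<z , z≼b) = meet y≼e z≼e
      where
      meet : y ≼₀ e → z ≼₀ e → ∃ λ y → d < y × y ≼₀ _ × y ≼₀ _
      meet (inj₂ refl) z≼e = z , d<z , ≼ᵀ-trans t z≼e y≼a , z≼b
      meet y≼e (inj₂ refl) = y , d<y , y≼a , ≼ᵀ-trans t y≼e z≼b
      meet (inj₁ y≺e) (inj₁ z≺e) with ≺-linear t y z e y≺e z≺e
      ... | inj₁ refl       = y , d<y , y≼a , z≼b
      ... | inj₂ (inj₁ y≺z) = y , d<y , y≼a , ≼ᵀ-trans t (inj₁ y≺z) z≼b
      ... | inj₂ (inj₂ z≺y) = z , d<z , ≼ᵀ-trans t (inj₁ z≺y) y≼a , z≼b

    closed′ : ∀ M a b c → M ∈ side p → IsMaximal t a → IsMaximal t b → a ≢ b →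
              F p a ∈ₛ M → F p b ∈ₛ M → c ≺₁ a → c ≺₁ b → c ∈ₛ M
    closed′ M a b c M∈ a-max b-max a≢b Fa∈M Fb∈M (keep c≺a) (keep c≺b) =
      closed p M a b c M∈ a-max b-max a≢b Fa∈M Fb∈M c≺a c≺b
    closed′ M a b c M∈ a-max b-max a≢b Fa∈M Fb∈M (below refl a-new) (below _ b-new) =
      let y , d<y , y≼a , y≼b = common a-new b-new
          y≺a , y≺b = branching a-max b-max a≢b y≼a y≼b
      in 𝒳-initial (All.lookup (proj₁ (adequate p)) M∈) (≺⇒<ω₁ t y≺a)
           (closed p M a b y M∈ a-max b-max a≢b Fa∈M Fb∈M y≺a y≺b) d<y
    closed′ M a b c M∈ a-max b-max _ _ _ (above refl _ _) _ = ⊥-elim (d∉ (proj₁ a-max))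
    closed′ M a b c M∈ a-max b-max _ _ _ _ (above refl _ _) = ⊥-elim (d∉ (proj₁ b-max))
    closed′ M a b c M∈ a-max b-max _ _ _ (keep d≺a) (below refl _) = ⊥-elim (d⊀ d≺a)
    closed′ M a b c M∈ a-max b-max _ _ _ (below refl _) (keep d≺b) = ⊥-elim (d⊀ d≺b)

    q : Condition
    q = record
      { tree        = t′
      ; F           = F p
      ; side        = side p
      ; F-injective = λ a b a-max b-max → F-injective p a b (max⁻ a-max) (max⁻ b-max)
      ; adequate    = adequate p
      ; closed      = λ M a b c M∈ a-max b-max a≢b Fa∈M Fb∈M c≺a c≺b →
          closed′ M a b c M∈ (max⁻ a-max) (max⁻ b-max) a≢b Fa∈M Fb∈M
                  (toWitness c≺a) (toWitness c≺b)
      }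

  abstract
    insert-large : ∀ p {η ζ e} → e < ω₁ → ζ < η → Large η e →
                   ∃ λ q → q ⊑ p × (∃ λ d → _≺_ (tree q) d e × Large ζ d)
    insert-large p {ζ = ζ} e<ω₁ ζ<η (large fresh) =
      let q , q⊑p , e∈ = add-node p e<ω₁
          -- Only now are the nodes to be avoided known, which is why `Large` quantifies over all
          -- lists.
          d , d<e , d∉ , d-large = fresh ζ ζ<η (nodes (tree q))
          q′ , q′⊑q , d≺e = insert-below q e∈ d<e d∉
      in q′ , ⊑-trans {q′} {q} {p} q′⊑q q⊑p , d , d≺e , d-large

-- Levels of the generic tree

module Levels (em : ExcludedMiddle 0ℓ) (S : Setting) (Γ : Setting.Ord S → Set) where
  open GenericTree S Γ
  open FiniteTree
  open OrdinalFacts em Ω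
  open Extensions em S Γ
  open ForcingFacts Condition _⊑_ (λ {p} → ⊑-refl {p}) (λ {p} {q} {r} → ⊑-trans {p} {q} {r})

  -- Check names and the tree relation

  checkAcc-≈ : ∀ {p} α (a b : Acc _<_ α) → p ⊩ checkAcc α a ≈ checkAcc α b
  checkAcc-≈ α (acc rs) (acc rs′) = setOf-≈
    (λ { (ξ , ξ<α) → ∈-respˡ (checkAcc-≈ ξ (rs′ ξ<α) (rs ξ<α)) (∈-setOf (ξ , ξ<α)) })
    (λ { (ξ , ξ<α) → ∈-respˡ (checkAcc-≈ ξ (rs ξ<α) (rs′ ξ<α)) (∈-setOf (ξ , ξ<α)) })

  check-∈ : ∀ {p α β} → α < β → p ⊩ check α ∈ check β
  check-∈ {α = α} {β} α<β with wellFounded β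
  ... | acc rs = ∈-respˡ (checkAcc-≈ α (rs α<β) (wellFounded α)) (∈-setOf (α , α<β))

  ∈-check-cases : ∀ {p a β} → p ⊩ a ∈ check β →
                  Dense p (λ r → ∃ λ α → α < β × r ⊩ a ≈ check α)
  ∈-check-cases {β = β} a∈β q q≤p with wellFounded β
  ... | acc rs with ∈-setOf-cases a∈β q q≤p
  ... | r , r≤q , (α , α<β) , a≈α =
    r , r≤q , α , α<β , ≈-trans a≈α (checkAcc-≈ α (rs α<β) (wellFounded α))

  check-injective : ∀ {p} α β → p ⊩ check α ≈ check β → α ≡ β
  check-injective α β e with compare α β
  ... | tri≈ _ α≡β _ = α≡β
  ... | tri< α<β _ _ = ⊥-elim (∈-irrefl (∈-respʳ (≈-sym e) (check-∈ α<β)))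
  ... | tri> _ _ β<α = ⊥-elim (∈-irrefl (∈-respʳ e (check-∈ β<α)))

  check-∈⁻ : ∀ {p α β} → p ⊩ check α ∈ check β → α < β
  check-∈⁻ {p} α∈β with ∈-check-cases α∈β p (⊑-refl {p})
  ... | r , _ , α′ , α′<β , e with check-injective _ _ e
  ... | refl = α′<β

  ≺⇒Ṙ : ∀ {p a b} → _≺_ (tree p) a b → p ⊩ opair (check a) (check b) ∈ Ṙ
  ≺⇒Ṙ {p} a≺b = ∈-element (p , _ , _ , a≺b) (⊑-refl {p})

  Ṙ-cases : ∀ {p x b} → p ⊩ opair x (check b) ∈ Ṙ →
            Dense p (λ r → ∃ λ a → _≺_ (tree r) a b × r ⊩ x ≈ check a)
  Ṙ-cases xb∈Ṙ q q≤p with ∈-cases xb∈Ṙ q q≤p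
  ... | r , r≤q , (s , a , b , a≺b) , r≤s , e with check-injective _ _ (opair-injectiveʳ e)
  ... | refl = r , r≤q , a , ⊑-≺ {r} {s} r≤s a≺b , opair-injectiveˡ e

  Ṙ⇒< : ∀ {p a b} → p ⊩ opair (check a) (check b) ∈ Ṙ → a < b
  Ṙ⇒< {p} ab∈Ṙ with Ṙ-cases ab∈Ṙ p (⊑-refl {p})
  ... | r , _ , a , a≺b , e with check-injective _ _ e
  ... | refl = ≺⇒< (tree r) _ _ a≺b

  -- The matrix of `HasHeight` for the generic tree, with the witnesses D and f exposed so that two
  -- collapses can be compared below one condition.
  Collapse : Name → Name → Name → Name → Stmt (lsuc 0ℓ)
  Collapse x α D f =
      (∀̇ λ y → y ∈̇ D ⇔̇ (y ∈̇ ω̌₁ ∧̇ opair y x ∈̇ Ṙ))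
    ∧̇ IsBijection f α D
    ∧̇ (∀̇ λ ξ → ∀̇ λ η → ∀̇ λ y → ∀̇ λ z →
         opair ξ y ∈̇ f ⇒̇ opair η z ∈̇ f ⇒̇ (ξ ∈̇ η ⇔̇ opair y z ∈̇ Ṙ))

  -- The composite g⁻¹ ; f is an isomorphism from the predecessors of x onto those
  -- of ξ.  If it maps e to ζ < η with e η-large, then a fresh ζ-large d inserted
  -- below e is mapped to some ζ′ < ζ, which leads to an infinite descent.
  module _ {r : Condition} {α D D′ f g : Name} {ξ x : Ord}
           (f-collapse : Collapse (check ξ) α D f r)
           (g-collapse : Collapse (check x) α D′ g r) where

    -- The composite sends e to ζ. The intermediate point σ remains a mere name; only e and ζ are
    -- ground-model ordinals.
    record Matched (q : Condition) (e ζ : Ord) : Set₁ where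
      field
        {σ}   : Name
        σe∈g : q ⊩ opair σ (check e) ∈ g
        σζ∈f : q ⊩ opair σ (check ζ) ∈ f

    abstract
      -- A preimage σ of e, its image y and the value of y each exist only densely, so the condition
      -- is extended three times. As y is a predecessor of ξ, its value is a node below ξ, where the
      -- descent starts.
      match : ∀ {q e} → q ⊑ r → _≺_ (tree q) e x →
              ∃ λ q′ → q′ ⊑ q × (∃ λ ζ → ζ < ξ × Matched q′ e ζ)
      match {q} {e} q≤r e≺x =
        let D-def , ((f-function , _) , _) , _ = f-collapse
            D′-def , (_ , g-onto) , _ = g-collapse
            e∈D′ = proj₂ (D′-def (check e)) q q≤r
              ( _⊩_∈_.forces (check-∈ {q} (≺⇒<ω₁ (tree q) e≺x))
              , _⊩_∈_.forces (≺⇒Ṙ {q} e≺x))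
            q₁ , q₁≤q , σ , σ∈α , σe∈g = g-onto (check e) q q≤r e∈D′ q (⊑-refl {q})
            q₁≤r = ⊑-trans {q₁} {q} {r} q₁≤q q≤r
            q₂ , q₂≤q₁ , y , y∈D , σy∈f =
              proj₁ (proj₂ f-function) σ q₁ q₁≤r σ∈α q₁ (⊑-refl {q₁})
            q₂≤r = ⊑-trans {q₂} {q₁} {r} q₂≤q₁ q₁≤r
            _ , yξ∈Ṙ = proj₁ (D-def y) q₂ q₂≤r y∈D
            q₃ , q₃≤q₂ , ζ , ζ≺ξ , y≈ζ = Ṙ-cases {q₂} {y} {ξ} (el yξ∈Ṙ) q₂ (⊑-refl {q₂})
            q₃≤q₁ = ⊑-trans {q₃} {q₂} {q₁} q₃≤q₂ q₂≤q₁
        in q₃ , ⊑-trans {q₃} {q₁} {q} q₃≤q₁ q₁≤q , ζ , ≺⇒< (tree q₃) ζ ξ ζ≺ξ , record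
             { σe∈g = ∈-mono q₃≤q₁ (el σe∈g)
             ; σζ∈f = ∈-respˡ (opair-cong ≈-refl y≈ζ) (∈-mono q₃≤q₂ (el σy∈f)) }

    matched-mono : ∀ {p q e ζ} → q ⊑ p → Matched p e ζ → Matched q e ζ
    matched-mono q≤p m = record { σe∈g = ∈-mono q≤p σe∈g ; σζ∈f = ∈-mono q≤p σζ∈f }
      where open Matched m

    matched-order : ∀ {q d e ζ′ ζ} → q ⊑ r → _≺_ (tree q) d e →
                    Matched q d ζ′ → Matched q e ζ → ζ′ < ζ
    matched-order {q} {d} {e} {ζ′} {ζ} q≤r d≺e m′ m = Ṙ⇒< {q} (el ζ′ζ∈Ṙ)
      where
      module M = Matched m
      module M′ = Matched m′
      q≤q = ⊑-refl {q}
      f-order = proj₂ (proj₂ f-collapse)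
      g-order = proj₂ (proj₂ g-collapse)

      σ′∈σ : (M′.σ ∈̇ M.σ) q
      σ′∈σ = proj₂ (g-order M′.σ M.σ (check d) (check e) q q≤r (_⊩_∈_.forces M′.σe∈g)
                      q q≤q (_⊩_∈_.forces M.σe∈g)) q q≤q (_⊩_∈_.forces (≺⇒Ṙ {q} d≺e))

      ζ′ζ∈Ṙ : (opair (check ζ′) (check ζ) ∈̇ Ṙ) q
      ζ′ζ∈Ṙ = proj₁ (f-order M′.σ M.σ (check ζ′) (check ζ) q q≤r (_⊩_∈_.forces M′.σζ∈f)
                       q q≤q (_⊩_∈_.forces M.σζ∈f)) q q≤q σ′∈σ

    -- The hypotheses reproduce themselves: the ζ-large d goes to ζ′ < ζ, so (ζ, d, ζ′) replaces (η,
    -- e, ζ). The condition is strengthened along the way, but the recursion is on ζ in the ground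
    -- model.
    no-descent : ∀ {q η e ζ} → Acc _<_ ζ → Large η e → q ⊑ r → _≺_ (tree q) e x →
                 ζ < η → ¬ Matched q e ζ
    no-descent {q} {e = e} (acc rs) e-large q≤r e≺x ζ<η m
      with insert-large q (≺⇒<ω₁ (tree q) e≺x) ζ<η e-large
    ... | q₁ , q₁≤q , d , d≺e , d-large
      with match {q₁} {d} (⊑-trans {q₁} {q} {r} q₁≤q q≤r)
             (≺-trans (tree q₁) d e x d≺e (⊑-≺ {q₁} {q} q₁≤q e≺x))
    ... | q₂ , q₂≤q₁ , ζ′ , _ , m′ =
      no-descent (rs ζ′<ζ) d-large q₂≤r (⊑-≺ {q₂} {q₁} q₂≤q₁ d≺x) ζ′<ζ m′
      where
      q₂≤q = ⊑-trans {q₂} {q₁} {q} q₂≤q₁ q₁≤q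
      q₂≤r = ⊑-trans {q₂} {q} {r} q₂≤q q≤r
      d≺x = ≺-trans (tree q₁) d e x d≺e (⊑-≺ {q₁} {q} q₁≤q e≺x)
      ζ′<ζ = matched-order q₂≤r (⊑-≺ {q₂} {q₁} q₂≤q₁ d≺e) m′ (matched-mono q₂≤q m)


    -- x is not among its own predecessors, so the descent starts one node lower, at a ξ-large d
    -- below x whose image is below ξ.
    large-not-matched : ∀ {η} → x < ω₁ → ξ < η → ¬ Large η x
    large-not-matched x<ω₁ ξ<η x-large =
      let q , q≤r , d , d≺x , d-large = insert-large r x<ω₁ ξ<η x-large
          q′ , q′≤q , ζ , ζ<ξ , m = match {q} {d} q≤r d≺x
      in no-descent (wellFounded ζ) d-large (⊑-trans {q′} {q} {r} q′≤q q≤r)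
           (⊑-≺ {q′} {q} q′≤q d≺x) ζ<ξ m

  bijection-mono : ∀ {p q f α D} → q ⊑ p → IsBijection f α D p → IsBijection f α D q
  bijection-mono {p} {q} q≤p (((graph , total , functional) , injective) , onto) =
    (((λ z s s≤q → graph z s (t s s≤q)) , (λ z s s≤q → total z s (t s s≤q))
     , (λ x y z s s≤q → functional x y z s (t s s≤q)))
    , (λ x y z s s≤q → injective x y z s (t s s≤q)))
    , (λ z s s≤q → onto z s (t s s≤q))
    where
    t : ∀ s → s ⊑ q → s ⊑ p
    t s s≤q = ⊑-trans {s} {q} {p} s≤q q≤p

  collapse-mono : ∀ {p q x α D f} → q ⊑ p → Collapse x α D f p → Collapse x α D f q
  collapse-mono {p} {q} q≤p (D-def , bijective , order) =
      (λ y → (λ s s≤q → proj₁ (D-def y) s (t s s≤q)) , (λ s s≤q → proj₂ (D-def y) s (t s s≤q)))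
    , bijection-mono {p} {q} q≤p bijective
    , (λ ξ η y z s s≤q → order ξ η y z s (t s s≤q))
    where
    t : ∀ s → s ⊑ q → s ⊑ p
    t s s≤q = ⊑-trans {s} {q} {p} s≤q q≤p

  same-height⇒¬large : ∀ {p α ξ x η} → HasHeight ω̌₁ Ṙ (check ξ) α p →
                       HasHeight ω̌₁ Ṙ (check x) α p → x < ω₁ → ξ < η → ¬ Large η x
  same-height⇒¬large {p} {α} {ξ} {x} ξ-height x-height =
    let q , q≤p , D , f-exists = ξ-height p (⊑-refl {p})
        q₁ , q₁≤q , f , f-collapse = f-exists q (⊑-refl {q})
        q₁≤p = ⊑-trans {q₁} {q} {p} q₁≤q q≤p
        q₂ , q₂≤q₁ , D′ , g-exists = x-height q₁ q₁≤p
        q₃ , q₃≤q₂ , g , g-collapse = g-exists q₂ (⊑-refl {q₂})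
        q₃≤q₁ = ⊑-trans {q₃} {q₂} {q₁} q₃≤q₂ q₂≤q₁
    in large-not-matched {q₃} {α} {D} {D′} {f} {g} {ξ} {x}
         (collapse-mono {q₁} {q₃} {check ξ} {α} {D} {f} q₃≤q₁ f-collapse) g-collapse

  -- Names for subsets of ω₁ bounded by a countable set of the ground model

  module _ (r : Condition) (L : Name)
           (L⊆ω₁ : ∀ {q x} → q ⊑ r → q ⊩ x ∈ L → q ⊩ x ∈ ω̌₁)
           (A : Ord → Set) (A-countable : Countable A)
           (L⊆A : ∀ {q ξ} → q ⊑ r → q ⊩ check ξ ∈ L → A ξ) where

    private
      code = proj₁ A-countable

    entry : (∃ λ ξ → ∃ λ q → q ⊩ check ξ ∈ L) → Name
    entry (ξ , _) = opair (check ξ) (numeral (code ξ))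

    -- The restriction to L of the ground-model injection `code`: a pair is put in under exactly
    -- those conditions that force its first coordinate into L.
    enumeration : Name
    enumeration = name _ entry (λ (_ , q , _) → q)

    ∈-enumeration : ∀ {q ξ} → q ⊩ check ξ ∈ L →
                    q ⊩ opair (check ξ) (numeral (code ξ)) ∈ enumeration
    ∈-enumeration {q} {ξ} ξ∈L =
      ∈-element {q} {x = entry} {λ (_ , p , _) → p} (ξ , q , ξ∈L) (⊑-refl {q})

    enumeration-cases : ∀ {q x y} → q ⊑ r → q ⊩ opair x y ∈ enumeration →
      Dense q (λ s → ∃ λ ξ → A ξ × s ⊩ x ≈ check ξ × s ⊩ y ≈ numeral (code ξ))
    enumeration-cases {q} q≤r xy∈ q′ q′≤q with ∈-cases xy∈ q′ q′≤q
    ... | s , s≤q′ , (ξ , p , ξ∈L) , s≤p , e = s , s≤q′ , ξ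
      -- p need not lie below r; s lies below both, so the membership is passed down to s before
      -- `L⊆A` applies.
      , L⊆A {s} {ξ} (⊑-trans {s} {q′} {r} s≤q′ (⊑-trans {q′} {q} {r} q′≤q q≤r)) (∈-mono s≤p ξ∈L)
      , opair-injectiveˡ e , opair-injectiveʳ e

    enumeration-common : ∀ {q x y u v} → q ⊑ r →
      q ⊩ opair x y ∈ enumeration → q ⊩ opair u v ∈ enumeration →
      Dense q (λ s → ∃ λ ξ → ∃ λ ζ → (A ξ × A ζ)
        × (s ⊩ x ≈ check ξ × s ⊩ y ≈ numeral (code ξ))
        × (s ⊩ u ≈ check ζ × s ⊩ v ≈ numeral (code ζ)))
    enumeration-common {q} q≤r xy∈ uv∈ q′ q′≤q with enumeration-cases q≤r xy∈ q′ q′≤q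
    ... | s , s≤q′ , ξ , Aξ , x≈ , y≈
      with enumeration-cases q≤r uv∈ s (⊑-trans {s} {q′} {q} s≤q′ q′≤q)
    ... | s′ , s′≤s , ζ , Aζ , uv≈ = s′ , ⊑-trans {s′} {s} {q′} s′≤s s≤q′ , ξ , ζ
      , (Aξ , Aζ) , (≈-mono s′≤s x≈ , ≈-mono s′≤s y≈) , uv≈

    enumeration-injective : IsInjection enumeration L ω̌ r
    enumeration-injective = (graph , total , functional) , injective
      where
      graph : (∀̇∈ enumeration λ z → ∃̇∈ L λ x → ∃̇∈ ω̌ λ y → z ≈̇ opair x y) r
      graph z q q≤r z∈ q′ q′≤q with ∈-cases (el {q} {z} {enumeration} z∈) q′ q′≤q
      ... | s , s≤q′ , (ξ , p , ξ∈L) , s≤p , e =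
        s , s≤q′ , check ξ , _⊩_∈_.forces (∈-mono s≤p ξ∈L) , λ s′ s′≤s →
          s′ , ⊑-refl {s′} , numeral (code ξ)
             , _⊩_∈_.forces (∈-setOf {s′} {x = numeral} (code ξ))
             , _⊩_≈_.forces (≈-mono s′≤s e)

      total : (∀̇∈ L λ x → ∃̇∈ ω̌ λ y → opair x y ∈̇ enumeration) r
      total x q q≤r x∈L q′ q′≤q
        with ∈-check-cases (L⊆ω₁ {x = x} q≤r (el x∈L)) q′ q′≤q
      ... | s , s≤q′ , ξ , _ , x≈ξ = s , s≤q′ , numeral (code ξ)
        , _⊩_∈_.forces (∈-setOf {s} {x = numeral} (code ξ))
        , _⊩_∈_.forces (∈-respˡ (opair-cong (≈-sym x≈ξ) ≈-refl)
            (∈-enumeration {s} (∈-respˡ x≈ξ (∈-mono s≤q (el x∈L)))))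
        where s≤q = ⊑-trans {s} {q′} {q} s≤q′ q′≤q

      functional : (∀̇ λ x → ∀̇ λ y → ∀̇ λ z →
        opair x y ∈̇ enumeration ⇒̇ opair x z ∈̇ enumeration ⇒̇ y ≈̇ z) r
      functional x y z q q≤r xy∈ q₁ q₁≤q xz∈ = _⊩_≈_.forces (≈-local λ q′ q′≤q₁ →
        let s , s≤q′ , ξ , ζ , _ , (x≈ξ , y≈) , (x≈ζ , z≈) =
              enumeration-common {q₁} {x} {y} {x} {z} (⊑-trans {q₁} {q} {r} q₁≤q q≤r)
                (∈-mono {q} {q₁} q₁≤q (el xy∈)) (el xz∈) q′ q′≤q₁
        in s , s≤q′ , ≈-trans y≈ (subst (λ ξ → s ⊩ numeral (code ξ) ≈ z)
             (check-injective ζ ξ (≈-trans (≈-sym x≈ζ) x≈ξ)) (≈-sym z≈)))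

      injective : (∀̇ λ x → ∀̇ λ y → ∀̇ λ z →
        opair x z ∈̇ enumeration ⇒̇ opair y z ∈̇ enumeration ⇒̇ x ≈̇ y) r
      injective x y z q q≤r xz∈ q₁ q₁≤q yz∈ = _⊩_≈_.forces (≈-local λ q′ q′≤q₁ →
        let s , s≤q′ , ξ , ζ , (Aξ , Aζ) , (x≈ξ , z≈) , (y≈ζ , z≈′) =
              enumeration-common {q₁} {x} {z} {y} {z} (⊑-trans {q₁} {q} {r} q₁≤q q≤r)
                (∈-mono {q} {q₁} q₁≤q (el xz∈)) (el yz∈) q′ q′≤q₁
            ζ≡ξ = proj₂ A-countable ζ ξ Aζ Aξ
                    (numeral-injective {s} _ _ (≈-trans (≈-sym z≈′) z≈))
        in s , s≤q′ , ≈-trans x≈ξ (subst (λ ξ → s ⊩ check ξ ≈ y) ζ≡ξ (≈-sym y≈ζ)))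

    countable : ∃ λ f → IsInjection f L ω̌ r
    countable = enumeration , enumeration-injective

  levels-countable : Forced (LevelsCountable ω̌₁ Ṙ)
  levels-countable _ α p _ _ L q q≤p level r r≤q
    with em {∃ λ s → s ⊑ r × (∃ λ ξ → s ⊩ check ξ ∈ L)}
  -- No extension of r decides a member of L, so L is forced empty and the empty set serves as
  -- bound.
  ... | no empty = r , ⊑-refl {r} , countable r L
          (λ {s} {x} s≤r x∈L → el (proj₁ (level-member {s} {x} s≤r x∈L)))
          (λ _ → ⊥) ((λ _ → zero) , λ _ _ ())
          (λ {s} {ξ} s≤r ξ∈L → empty (s , s≤r , ξ , ξ∈L))
    where
    level-member : ∀ {s x} → s ⊑ r → s ⊩ x ∈ L → (x ∈̇ ω̌₁ ∧̇ HasHeight ω̌₁ Ṙ x α) s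
    level-member {s} {x} s≤r (el x∈L) =
      proj₁ (level x) s (⊑-trans {s} {r} {q} s≤r r≤q) x∈L
  -- A single decided member ξ has height α and thereby bounds all of L below s.
  ... | yes (s , s≤r , ξ , ξ∈L) = s , s≤r , countable s L
          (λ {t} {x} t≤s x∈L → el (proj₁ (level-member {t} {x} t≤s x∈L)))
          (Below β) (<ω₁-countable β β<ω₁) L⊆β
    where
    level-member : ∀ {t x} → t ⊑ s → t ⊩ x ∈ L → (x ∈̇ ω̌₁ ∧̇ HasHeight ω̌₁ Ṙ x α) t
    level-member {t} {x} t≤s (el x∈L) = proj₁ (level x) t
      (⊑-trans {t} {s} {q} t≤s (⊑-trans {s} {r} {q} s≤r r≤q)) x∈L

    ξ<ω₁ = check-∈⁻ {s} (el (proj₁ (level-member {s} {check ξ} (⊑-refl {s}) ξ∈L)))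
    -- The index of largeness must strictly exceed ξ, so that a ξ-large node can be inserted below x
    -- to start the descent.
    above-ξ = suc-below-ω₁ ξ<ω₁
    threshold = eventually-large (proj₁ (proj₂ above-ξ))
    β = proj₁ threshold
    β<ω₁ = proj₁ (proj₂ threshold)

    L⊆β : ∀ {t x} → t ⊑ s → t ⊩ check x ∈ L → x < β
    L⊆β {t} {x} t≤s x∈L = ≰⇒> λ β≤x →
      let x∈ω₁ , x-height = level-member {t} {check x} t≤s x∈L
          _ , ξ-height = level-member {t} {check ξ} t≤s (∈-mono {s} {t} t≤s ξ∈L)
      in same-height⇒¬large {t} {α} {ξ} {x} ξ-height x-height (check-∈⁻ {t} (el x∈ω₁))
           (proj₂ (proj₂ above-ξ)) (proj₂ (proj₂ threshold) x β≤x)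

lemma7p6 : ExcludedMiddle (lsuc 0ℓ) →
    (S : Setting) (Γ : Setting.Ord S → Set) →
    let open GenericTree S Γ in
    (∀ β → Γ β → Λ β) →
    IsStationary Γ →
    Forced (IsCardinal ω̌₁) →
    Forced (IsCardinal ω̌₂) →
    Forced (LevelsCountable ω̌₁ Ṙ)
lemma7p6 em₁ S Γ _ _ _ _ = Levels.levels-countable em S Γ
  where
  em : ExcludedMiddle 0ℓ
  em {P} = map′ lower lift (em₁ {Lift (lsuc 0ℓ) P})
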